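{- Let $\mathbf{k}$ be a field of arbitrary characteristic. Suppose that $f\in 2^{[m]*}$ is nice and that $K_f=\mathrm{supp}(f)$ is an abstract simplicial complex on vertex set $[m]$. Then, in $2^{[m]*}$, $$\mathcal{M}(f)=\sum_{i=0}^h\sum_{a\in 2^{[m]}} \beta_{i, a}^{\mathbf{k}(K_f)}\,\delta_a,$$ where $h$ denotes the length of the minimal free resolution of $\mathbf{k}(K_f)$ and $\beta_{i,a}^{\mathbf{k}(K_f)}$ are the Betti numbers of $\mathbf{k}(K_f)$ (their residues modulo $2$ are used as coefficients).
   Context: Let $m$ be a positive integer, $[m]=\{1,\dots,m\}$, and $2^{[m]}$ the power set of $[m]$. $2^{[m]*}$ is the $\mathbb{Z}/2\mathbb{Z}$-algebra of all functions $f:2^{[m]}\to\mathbb{Z}/2\mathbb{Z}=\{0,1\}$ with pointwise operations. For $a\in 2^{[m]}$, $\delta_a\in 2^{[m]*}$ is defined by $\delta_a(b)=1\Leftrightarrow b=a$. The support is $\mathrm{supp}(f)=f^{ -1}(1)\subseteq 2^{[m]}$. An abstract simplicial complex is a collection of subsets closed under taking subsets (including the empty set); it is on vertex set $[m]$ if the union of its members is $[m]$. $f$ is nice if $\mathrm{supp}(f)$ is an abstract simplicial complex. The $\mathbb{Z}/2\mathbb{Z}$-valued Möbius transform $\mathcal{M}:2^{[m]*}\to 2^{[m]*}$ is $\mathcal{M}(f)(a)=\sum_{b\subseteq a}f(b)$. Let $\mathbf{k}[\mathbf{v}]=\mathbf{k}[v_1,\dots,v_m]$ with its $\mathbb{N}^m$-grading.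 For $a\subseteq[m]$ put $\mathbf{v}^a=\prod_{i\in a}v_i$. The Stanley–Reisner face ring of a complex $K$ on $[m]$ is $\mathbf{k}(K)=\mathbf{k}[\mathbf{v}]/\langle \mathbf{v}^\tau\mid \tau\subseteq[m],\ \tau\notin K\rangle$. It has an $\mathbb{N}^m$-graded minimal free resolution $0\leftarrow \mathbf{k}(K)\leftarrow F_0\leftarrow F_1\leftarrow\cdots\leftarrow F_h\leftarrow 0$ over $\mathbf{k}[\mathbf{v}]$, with $F_i=\bigoplus_{\mathbf{a}\in\mathbb{N}^m}\mathbf{k}[\mathbf{v}](-\mathbf{a})^{\beta_{i,\mathbf{a}}^{\mathbf{k}(K)}}$, where $\mathbf{k}[\mathbf{v}](-\mathbf{a})$ is the free module generated in degree $\mathbf{a}$. For $a\in 2^{[m]}$, the Betti number $\beta_{i,a}^{\mathbf{k}(K)}$ means $\beta_{i,\mathbf{a}}^{\mathbf{k}(K)}$ with $\mathbf{a}\in\{0,1\}^m$ the indicator vector of $a$ (it is known that $\beta_{i,\mathbf{a}}^{\mathbf{k}(K)}=0$ for $\mathbf{a}\notin\{0,1\}^m$). -}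

module Defs where

open import Level using (Level; _⊔_; 0ℓ)
open import Algebra.Apartness.Bundles using (HeytingCommutativeRing; HeytingField)
open import Algebra.Bundles using (CommutativeRing)
open import Algebra.Module.Bundles using (Module)
import Algebra.Construct.Pointwise as Pointwise
open import Algebra.Module.Morphism.Structures using (IsModuleHomomorphism)
open import Algebra.Module.Structures.Biased using (IsModuleFromLeft)
import Algebra.Properties.Ring as RingProperties
open import Data.Bool.Base using (true; false; if_then_else_)
import Data.Bool.Properties as Bool
open import Data.Fin.Base using (Fin)
open import Data.Fin.Subset using (Subset; inside; outside; _∈_; _⊆_; ⊥; ⁅_⁆)
open import Data.Fin.Subset.Properties using (_⊆?_)
open import Data.List.Base as List using (List; []; _∷_; _++_; length; filter; foldr)
open import Data.Nat.Base as ℕ using (ℕ; zero; suc)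
import Data.Nat.Properties as ℕ
open import Data.Parity.Base as ℙ using (Parity; 0ℙ; 1ℙ)
import Data.Parity.Properties as ℙ
open import Data.Product.Base using (∃; _×_; _,_)
open import Data.Vec.Base as Vec using (Vec; []; _∷_)
open import Data.Vec.Functional using (Vector)
import Data.Vec.Properties as Vec
open import Function.Base using (flip)
open import Function.Bundles using (mk⇔)
open import Relation.Binary.Definitions using (DecidableEquality)
open import Relation.Binary.PropositionalEquality as ≡ using (_≡_; _≢_)
import Relation.Binary.Reasoning.Setoid as SetoidReasoning
open import Relation.Nullary using (¬_; Dec; yes; no; does)
open import Relation.Nullary.Decidable using (does-⇔; dec-false)
open import Relation.Unary using (Pred)

private
  variable
    m : ℕ
    c ℓ s : Level

2^[_]* : ℕ → CommutativeRing 0ℓ 0ℓ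
2^[ m ]* = Pointwise.commutativeRing (Subset m) ℙ.+-*-commutativeRing

module 2^[_]* (m : ℕ) = CommutativeRing 2^[ m ]*

infixr 7 _·_
_·_ : Parity → 2^[_]*.Carrier m → 2^[_]*.Carrier m
(p · f) b = p ℙ.* f b

subsets : ∀ m → List (Subset m)
subsets zero    = [] ∷ []
subsets (suc m) = List.map (outside ∷_) (subsets m) ++ List.map (inside ∷_) (subsets m)

_≟ˢ_ : DecidableEquality (Subset m)
_≟ˢ_ = Vec.≡-dec Bool._≟_

δ : Subset m → 2^[_]*.Carrier m
δ a b = if does (b ≟ˢ a) then 1ℙ else 0ℙ

∑ : List (2^[_]*.Carrier m) → 2^[_]*.Carrier m
∑ {m} = foldr (2^[_]*._+_ m) (2^[_]*.0# m)

ℳ : 2^[_]*.Carrier m → 2^[_]*.Carrier m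
ℳ {m} f a = foldr ℙ._+_ 0ℙ (List.map f (filter (_⊆? a) (subsets m)))

supp : 2^[_]*.Carrier m → Pred (Subset m) 0ℓ
supp f a = f a ≡ 1ℙ

record IsSimplicialComplex (K : Pred (Subset m) 0ℓ) : Set where
  field
    ∅-face      : K ⊥
    down-closed : ∀ {a b} → b ⊆ a → K a → K b

OnVertexSet[m] : Pred (Subset m) 0ℓ → Set
OnVertexSet[m] {m} K = ∀ (i : Fin m) → ∃ λ a → K a × i ∈ a

Nice : 2^[_]*.Carrier m → Set
Nice f = IsSimplicialComplex (supp f)

Degree : ℕ → Set
Degree m = Vec ℕ m

infixl 6 _⊕_
_⊕_ : Degree m → Degree m → Degree m
_⊕_ = Vec.zipWith ℕ._+_

𝟎 : Degree m
𝟎 = Vec.replicate _ 0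

_≟ᵈ_ : DecidableEquality (Degree m)
_≟ᵈ_ = Vec.≡-dec ℕ._≟_

indicator : Subset m → Degree m
indicator = Vec.map (λ b → if b then 1 else 0)

⊕-assoc : (a b e : Degree m) → (a ⊕ b) ⊕ e ≡ a ⊕ (b ⊕ e)
⊕-assoc = Vec.zipWith-assoc ℕ.+-assoc

⊕-comm : (a b : Degree m) → a ⊕ b ≡ b ⊕ a
⊕-comm = Vec.zipWith-comm ℕ.+-comm

⊕-identityˡ : (a : Degree m) → 𝟎 ⊕ a ≡ a
⊕-identityˡ = Vec.zipWith-identityˡ ℕ.+-identityˡ

⊕-cancelˡ : (a : Degree m) {b e : Degree m} → a ⊕ b ≡ a ⊕ e → b ≡ e
⊕-cancelˡ []      {[]}    {[]}    _  = ≡.refl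
⊕-cancelˡ (x ∷ a) {y ∷ b} {z ∷ e} eq =
  ≡.cong₂ _∷_ (ℕ.+-cancelˡ-≡ x y z (Vec.∷-injectiveˡ eq))
              (⊕-cancelˡ a (Vec.∷-injectiveʳ eq))

subtract? : (a e : Degree m) → Dec (∃ λ b → a ⊕ b ≡ e)
subtract? []      []      = yes ([] , ≡.refl)
subtract? (x ∷ a) (y ∷ e) with x ℕ.≤? y | subtract? a e
... | yes x≤y | yes (b , eq) = yes ((y ℕ.∸ x) ∷ b , ≡.cong₂ _∷_ (ℕ.m+[n∸m]≡n x≤y) eq)
... | no  x≰y | _            = no λ { (z ∷ b , eq) →
  x≰y (ℕ.≤-trans (ℕ.m≤m+n x z) (ℕ.≤-reflexive (Vec.∷-injectiveˡ eq))) }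
... | yes _   | no  ¬b       = no λ { (z ∷ b , eq) → ¬b (b , Vec.∷-injectiveʳ eq) }

module _ (R : CommutativeRing c ℓ) where
  open CommutativeRing R

  data ⟨_⟩ (S : Pred Carrier s) : Pred Carrier (c ⊔ ℓ ⊔ s) where
    generator : ∀ {x} → S x → ⟨ S ⟩ x
    0∈        : ⟨ S ⟩ 0#
    +-closed  : ∀ {x y} → ⟨ S ⟩ x → ⟨ S ⟩ y → ⟨ S ⟩ (x + y)
    *-closed  : ∀ r {x} → ⟨ S ⟩ x → ⟨ S ⟩ (r * x)
    resp-≈    : ∀ {x y} → x ≈ y → ⟨ S ⟩ x → ⟨ S ⟩ y

  -- A record rather than a function, so that x and y can be inferred.
  record _≈_mod⟨_⟩ (x y : Carrier) (S : Pred Carrier s) : Set (c ⊔ ℓ ⊔ s) where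
    constructor mk≈
    field difference : ⟨ S ⟩ (x - y)

  module _ (S : Pred Carrier s) where
    open RingProperties ring using (-1*x≈-x; -‿+-comm; -‿involutive; -‿distribʳ-*)
    open SetoidReasoning setoid

    private
      infix 4 _~_
      _~_ : Carrier → Carrier → Set (c ⊔ ℓ ⊔ s)
      x ~ y = x ≈ y mod⟨ S ⟩

      negate : ∀ {x} → ⟨ S ⟩ x → ⟨ S ⟩ (- x)
      negate {x} p = resp-≈ (-1*x≈-x x) (*-closed (- 1#) p)

      swap-middle : ∀ a b d e → (a + b) + (d + e) ≈ (a + d) + (b + e)
      swap-middle a b d e = begin
        (a + b) + (d + e)  ≈⟨ +-assoc a b (d + e) ⟩
        a + (b + (d + e))  ≈⟨ +-congˡ (+-assoc b d e) ⟨
        a + ((b + d) + e)  ≈⟨ +-congˡ (+-congʳ (+-comm b d)) ⟩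
        a + ((d + b) + e)  ≈⟨ +-congˡ (+-assoc d b e) ⟩
        a + (d + (b + e))  ≈⟨ +-assoc a d (b + e) ⟨
        (a + d) + (b + e)  ∎

      telescope : ∀ x y z → (x - y) + (y - z) ≈ x - z
      telescope x y z = begin
        (x - y) + (y - z)      ≈⟨ +-assoc x (- y) (y - z) ⟩
        x + (- y + (y - z))    ≈⟨ +-congˡ (+-assoc (- y) y (- z)) ⟨
        x + ((- y + y) - z)    ≈⟨ +-congˡ (+-congʳ (-‿inverseˡ y)) ⟩
        x + (0# - z)           ≈⟨ +-congˡ (+-identityˡ (- z)) ⟩
        x - z                  ∎

      flip-difference : ∀ x y → - (x - y) ≈ y - x
      flip-difference x y = begin
        - (x - y)      ≈⟨ -‿+-comm x (- y) ⟨
        - x + - (- y)  ≈⟨ +-congˡ (-‿involutive y) ⟩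
        - x + y        ≈⟨ +-comm (- x) y ⟩
        y - x          ∎

    ≈⇒≈mod : ∀ {x y} → x ≈ y → x ~ y
    ≈⇒≈mod {x} {y} x≈y = mk≈ (resp-≈ (sym (trans (+-congʳ x≈y) (-‿inverseʳ y))) 0∈)

    private
      ~-sym : ∀ {x y} → x ~ y → y ~ x
      ~-sym {x} {y} (mk≈ p) = mk≈ (resp-≈ (flip-difference x y) (negate p))

      ~-trans : ∀ {x y z} → x ~ y → y ~ z → x ~ z
      ~-trans {x} {y} {z} (mk≈ p) (mk≈ q) = mk≈ (resp-≈ (telescope x y z) (+-closed p q))

      +-cong~ : ∀ {x x′ y y′} → x ~ x′ → y ~ y′ → x + y ~ x′ + y′
      +-cong~ {x} {x′} {y} {y′} (mk≈ p) (mk≈ q) = mk≈ (resp-≈ eq (+-closed p q))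
        where
        eq : (x - x′) + (y - y′) ≈ (x + y) - (x′ + y′)
        eq = trans (swap-middle x (- x′) y (- y′)) (+-congˡ (-‿+-comm x′ y′))

      neg-cong~ : ∀ {x y} → x ~ y → - x ~ - y
      neg-cong~ {x} {y} (mk≈ p) = mk≈ (resp-≈ (sym (-‿+-comm x (- y))) (negate p))

      *-congˡ~ : ∀ x {y z} → y ~ z → x * y ~ x * z
      *-congˡ~ x {y} {z} (mk≈ p) = mk≈ (resp-≈ eq (*-closed x p))
        where
        eq : x * (y - z) ≈ x * y - x * z
        eq = trans (distribˡ x y (- z)) (+-congˡ (sym (-‿distribʳ-* x z)))

      *-cong~ : ∀ {x x′ y y′} → x ~ x′ → y ~ y′ → x * y ~ x′ * y′
      *-cong~ {x} {x′} {y} {y′} p q =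
        ~-trans (*-congˡ~ x q)
          (~-trans (≈⇒≈mod (*-comm x y′))
            (~-trans (*-congˡ~ y′ p) (≈⇒≈mod (*-comm y′ x′))))

    quotientRing : CommutativeRing c (c ⊔ ℓ ⊔ s)
    quotientRing = record
      { _≈_ = _~_ ; _+_ = _+_ ; _*_ = _*_ ; -_ = -_ ; 0# = 0# ; 1# = 1#
      ; isCommutativeRing = record
        { isRing = record
          { +-isAbelianGroup = record
            { isGroup = record
              { isMonoid = record
                { isSemigroup = record
                  { isMagma = record
                    { isEquivalence = record
                      { refl = ≈⇒≈mod refl ; sym = ~-sym ; trans = ~-trans }
                    ; ∙-cong = +-cong~
                    }
                  ; assoc = λ x y z → ≈⇒≈mod (+-assoc x y z)
                  }
                ; identity = (λ x → ≈⇒≈mod (+-identityˡ x)) , (λ x → ≈⇒≈mod (+-identityʳ x))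
                }
              ; inverse = (λ x → ≈⇒≈mod (-‿inverseˡ x)) , (λ x → ≈⇒≈mod (-‿inverseʳ x))
              ; ⁻¹-cong = neg-cong~
              }
            ; comm = λ x y → ≈⇒≈mod (+-comm x y)
            }
          ; *-cong = *-cong~
          ; *-assoc = λ x y z → ≈⇒≈mod (*-assoc x y z)
          ; *-identity = (λ x → ≈⇒≈mod (*-identityˡ x)) , (λ x → ≈⇒≈mod (*-identityʳ x))
          ; distrib = (λ x y z → ≈⇒≈mod (distribˡ x y z)) , (λ x y z → ≈⇒≈mod (distribʳ x y z))
          }
        ; *-comm = λ x y → ≈⇒≈mod (*-comm x y)
        }
      }

    private module Q = CommutativeRing quotientRing

    quotientModule : Module R c (c ⊔ ℓ ⊔ s)
    quotientModule = record
      { Carrierᴹ = Carrier ; _≈ᴹ_ = _~_ ; _+ᴹ_ = _+_ ; _*ₗ_ = _*_ ; _*ᵣ_ = flip _*_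
      ; 0ᴹ = 0# ; -ᴹ_ = -_
      ; isModule = IsModuleFromLeft.isModule {commutativeRing = R} (record
        { isLeftModule = record
          { isLeftSemimodule = record
            { +ᴹ-isCommutativeMonoid = Q.+-isCommutativeMonoid
            ; isPreleftSemimodule = record
              { *ₗ-cong      = λ p → Q.*-cong (≈⇒≈mod p)
              ; *ₗ-zeroˡ     = Q.zeroˡ
              ; *ₗ-distribʳ  = Q.distribʳ
              ; *ₗ-identityˡ = Q.*-identityˡ
              ; *ₗ-assoc     = Q.*-assoc
              ; *ₗ-zeroʳ     = Q.zeroʳ
              ; *ₗ-distribˡ  = Q.distribˡ
              }
            }
          ; -ᴹ‿cong    = Q.-‿cong
          ; -ᴹ‿inverse = Q.-‿inverse
          }
        })
      }

  freeModule : ℕ → Module R c ℓ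
  freeModule n = record
    { Carrierᴹ = Vector Carrier n ; _≈ᴹ_ = P._≈_ ; _+ᴹ_ = P._+_
    ; _*ₗ_ = λ r x j → r * x j ; _*ᵣ_ = λ x r j → r * x j
    ; 0ᴹ = P.0# ; -ᴹ_ = P.-_
    ; isModule = IsModuleFromLeft.isModule {commutativeRing = R} (record
      { isLeftModule = record
        { isLeftSemimodule = record
          { +ᴹ-isCommutativeMonoid = P.+-isCommutativeMonoid
          ; isPreleftSemimodule = record
            { *ₗ-cong      = λ p q j → *-cong p (q j)
            ; *ₗ-zeroˡ     = λ x j → zeroˡ (x j)
            ; *ₗ-distribʳ  = λ x r t j → distribʳ (x j) r t
            ; *ₗ-identityˡ = λ x j → *-identityˡ (x j)
            ; *ₗ-assoc     = λ r t x j → *-assoc r t (x j)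
            ; *ₗ-zeroʳ     = λ r j → zeroʳ r
            ; *ₗ-distribˡ  = λ r x y j → distribˡ r (x j) (y j)
            }
          }
        ; -ᴹ‿cong    = P.-‿cong
        ; -ᴹ‿inverse = P.-‿inverse
        }
      })
    }
    where module P = CommutativeRing (Pointwise.commutativeRing (Fin n) R)

module Polynomials (R : CommutativeRing c ℓ) (m : ℕ) where
  open CommutativeRing R
  open RingProperties ring using (-0#≈0#; -‿+-comm; -‿distribˡ-*)
  open SetoidReasoning setoid

  -- A finite formal sum of terms r · v^e; the same exponent may occur
  -- repeatedly, and polynomials are identified when all their
  -- coefficients agree.
  Poly : Set c
  Poly = List (Carrier × Degree m)

  coeff : Poly → Degree m → Carrier
  coeff []            e = 0#
  coeff ((r , a) ∷ p) e = (if does (a ≟ᵈ e) then r else 0#) + coeff p e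

  infix 4 _≈ᴾ_
  record _≈ᴾ_ (p q : Poly) : Set ℓ where
    constructor mk≈ᴾ
    field coeff-≈ : ∀ e → coeff p e ≈ coeff q e
  open _≈ᴾ_ public

  monomial : Degree m → Poly
  monomial e = (1# , e) ∷ []

  -- v^a = ∏_{i∈a} vᵢ is the monomial whose exponent is the indicator vector of a.
  v^_ : Subset m → Poly
  v^ a = monomial (indicator a)

  var : Fin m → Poly
  var i = v^ ⁅ i ⁆

  infixl 7 _*ᴾ_
  _*ᴾ_ : Poly → Poly → Poly
  []            *ᴾ q = []
  ((r , a) ∷ p) *ᴾ q = List.map (λ (t , b) → r * t , a ⊕ b) q ++ p *ᴾ q

  -ᴾ_ : Poly → Poly
  -ᴾ_ = List.map λ (r , a) → - r , a

  -- The value at p of the linear functional v^e ↦ g e.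
  pair : Poly → (Degree m → Carrier) → Carrier
  pair []            g = 0#
  pair ((r , a) ∷ p) g = r * g a + pair p g

  kronecker : Degree m → Degree m → Carrier
  kronecker e a = if does (a ≟ᵈ e) then 1# else 0#

  coeff≈pair : ∀ p e → coeff p e ≈ pair p (kronecker e)
  coeff≈pair []            e = refl
  coeff≈pair ((r , a) ∷ p) e = +-cong (scale (does (a ≟ᵈ e))) (coeff≈pair p e)
    where
    scale : ∀ b → (if b then r else 0#) ≈ r * (if b then 1# else 0#)
    scale true  = sym (*-identityʳ r)
    scale false = sym (zeroʳ r)

  pair-cong : ∀ p {g h} → (∀ a → g a ≈ h a) → pair p g ≈ pair p h
  pair-cong []            g≈h = refl
  pair-cong ((r , a) ∷ p) g≈h = +-cong (*-congˡ (g≈h a)) (pair-cong p g≈h)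

  pair-++ : ∀ p q g → pair (p ++ q) g ≈ pair p g + pair q g
  pair-++ []            q g = sym (+-identityˡ _)
  pair-++ ((r , a) ∷ p) q g = trans (+-congˡ (pair-++ p q g)) (sym (+-assoc _ _ _))

  pair-neg : ∀ p g → pair (-ᴾ p) g ≈ - pair p g
  pair-neg []            g = sym -0#≈0#
  pair-neg ((r , a) ∷ p) g =
    trans (+-cong (sym (-‿distribˡ-* r (g a))) (pair-neg p g)) (-‿+-comm _ _)

  pair-zero : ∀ p → pair p (λ _ → 0#) ≈ 0#
  pair-zero []            = refl
  pair-zero ((r , a) ∷ p) = trans (+-cong (zeroʳ r) (pair-zero p)) (+-identityˡ 0#)

  private
    swap-middle : ∀ a b d e → (a + b) + (d + e) ≈ (a + d) + (b + e)
    swap-middle a b d e = begin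
      (a + b) + (d + e)  ≈⟨ +-assoc a b (d + e) ⟩
      a + (b + (d + e))  ≈⟨ +-congˡ (+-assoc b d e) ⟨
      a + ((b + d) + e)  ≈⟨ +-congˡ (+-congʳ (+-comm b d)) ⟩
      a + ((d + b) + e)  ≈⟨ +-congˡ (+-assoc d b e) ⟩
      a + (d + (b + e))  ≈⟨ +-assoc a d (b + e) ⟨
      (a + d) + (b + e)  ∎

  pair-+ : ∀ p g h → pair p (λ a → g a + h a) ≈ pair p g + pair p h
  pair-+ []            g h = sym (+-identityˡ 0#)
  pair-+ ((r , a) ∷ p) g h =
    trans (+-cong (distribˡ r (g a) (h a)) (pair-+ p g h)) (swap-middle _ _ _ _)

  pair-* : ∀ p t g → pair p (λ a → t * g a) ≈ t * pair p g
  pair-* []            t g = sym (zeroʳ t)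
  pair-* ((r , a) ∷ p) t g = begin
    r * (t * g a) + pair p (λ a → t * g a)  ≈⟨ +-cong (*-assoc r t (g a)) (sym (pair-* p t g)) ⟨
    (r * t) * g a + t * pair p g            ≈⟨ +-congʳ (*-congʳ (*-comm r t)) ⟩
    (t * r) * g a + t * pair p g            ≈⟨ +-congʳ (*-assoc t r (g a)) ⟩
    t * (r * g a) + t * pair p g            ≈⟨ distribˡ t _ _ ⟨
    t * (r * g a + pair p g)                ∎

  pair-swap : ∀ p q (g : Degree m → Degree m → Carrier) →
              pair p (λ a → pair q (g a)) ≈ pair q (λ b → pair p (λ a → g a b))
  pair-swap []            q g = sym (pair-zero q)
  pair-swap ((r , a) ∷ p) q g = begin
    r * pair q (g a) + pair p (λ a → pair q (g a))
      ≈⟨ +-cong (sym (pair-* q r (g a))) (pair-swap p q g) ⟩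
    pair q (λ b → r * g a b) + pair q (λ b → pair p (λ a → g a b))
      ≈⟨ pair-+ q _ _ ⟨
    pair q (λ b → r * g a b + pair p (λ a → g a b))
      ∎

  pair-*ᴾ : ∀ p q g → pair (p *ᴾ q) g ≈ pair p (λ a → pair q (λ b → g (a ⊕ b)))
  pair-*ᴾ []            q g = refl
  pair-*ᴾ ((r , a) ∷ p) q g =
    trans (pair-++ (List.map _ q) (p *ᴾ q) g) (+-cong (term q) (pair-*ᴾ p q g))
    where
    term : ∀ q → pair (List.map (λ (t , b) → r * t , a ⊕ b) q) g ≈ r * pair q (λ b → g (a ⊕ b))
    term []            = sym (zeroʳ r)
    term ((t , b) ∷ q) = trans (+-cong (*-assoc r t _) (term q)) (sym (distribˡ r _ _))

  -- The functional q ↦ (coefficient of v^e in v^a q) respects _≈ᴾ_.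
  pair-shift : ∀ a e {q q′} → q ≈ᴾ q′ →
               pair q (λ b → kronecker e (a ⊕ b)) ≈ pair q′ (λ b → kronecker e (a ⊕ b))
  pair-shift a e {q} {q′} q≈q′ with subtract? a e
  ... | yes (d , ≡.refl) = begin
    pair q (λ b → kronecker (a ⊕ d) (a ⊕ b))   ≈⟨ pair-cong q same ⟩
    pair q (kronecker d)                       ≈⟨ coeff≈pair q d ⟨
    coeff q d                                  ≈⟨ coeff-≈ q≈q′ d ⟩
    coeff q′ d                                 ≈⟨ coeff≈pair q′ d ⟩
    pair q′ (kronecker d)                      ≈⟨ pair-cong q′ same ⟨
    pair q′ (λ b → kronecker (a ⊕ d) (a ⊕ b))  ∎
    where
    same : ∀ b → kronecker (a ⊕ d) (a ⊕ b) ≈ kronecker d b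
    same b = reflexive (≡.cong (λ z → if z then 1# else 0#)
      (does-⇔ (mk⇔ (⊕-cancelˡ a) (≡.cong (a ⊕_))) ((a ⊕ b) ≟ᵈ (a ⊕ d)) (b ≟ᵈ d)))
  ... | no ¬d = trans (vanish q) (sym (vanish q′))
    where
    vanish : ∀ q → pair q (λ b → kronecker e (a ⊕ b)) ≈ 0#
    vanish q = trans
      (pair-cong q λ b → reflexive (≡.cong (λ z → if z then 1# else 0#)
        (dec-false ((a ⊕ b) ≟ᵈ e) (λ eq → ¬d (b , eq)))))
      (pair-zero q)

  private
    ≈ᴾ-byPairing : ∀ {p q} → (∀ g → pair p g ≈ pair q g) → p ≈ᴾ q
    ≈ᴾ-byPairing {p} {q} eq = mk≈ᴾ λ e →
      trans (coeff≈pair p e) (trans (eq (kronecker e)) (sym (coeff≈pair q e)))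

    pairs : ∀ {p q} → p ≈ᴾ q → ∀ e → pair p (kronecker e) ≈ pair q (kronecker e)
    pairs {p} {q} p≈q e = trans (sym (coeff≈pair p e)) (trans (coeff-≈ p≈q e) (coeff≈pair q e))

    ≈ᴾ-fromPairs : ∀ {p q} → (∀ e → pair p (kronecker e) ≈ pair q (kronecker e)) → p ≈ᴾ q
    ≈ᴾ-fromPairs {p} {q} eq = mk≈ᴾ λ e →
      trans (coeff≈pair p e) (trans (eq e) (sym (coeff≈pair q e)))

    ≈ᴾ-trans : ∀ {p q r} → p ≈ᴾ q → q ≈ᴾ r → p ≈ᴾ r
    ≈ᴾ-trans p≈q q≈r = mk≈ᴾ λ e → trans (coeff-≈ p≈q e) (coeff-≈ q≈r e)

    comm+ : ∀ p q → p ++ q ≈ᴾ q ++ p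
    comm+ p q = ≈ᴾ-byPairing λ g →
      trans (pair-++ p q g) (trans (+-comm _ _) (sym (pair-++ q p g)))

    cong+ : ∀ {p p′ q q′} → p ≈ᴾ p′ → q ≈ᴾ q′ → p ++ q ≈ᴾ p′ ++ q′
    cong+ {p} {p′} {q} {q′} p≈ q≈ = ≈ᴾ-fromPairs λ e →
      trans (pair-++ p q _) (trans (+-cong (pairs p≈ e) (pairs q≈ e)) (sym (pair-++ p′ q′ _)))

    assoc+ : ∀ p q r → (p ++ q) ++ r ≈ᴾ p ++ (q ++ r)
    assoc+ p q r = ≈ᴾ-byPairing λ g → begin
      pair ((p ++ q) ++ r) g            ≈⟨ pair-++ (p ++ q) r g ⟩
      pair (p ++ q) g + pair r g        ≈⟨ +-congʳ (pair-++ p q g) ⟩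
      (pair p g + pair q g) + pair r g  ≈⟨ +-assoc _ _ _ ⟩
      pair p g + (pair q g + pair r g)  ≈⟨ +-congˡ (pair-++ q r g) ⟨
      pair p g + pair (q ++ r) g        ≈⟨ pair-++ p (q ++ r) g ⟨
      pair (p ++ (q ++ r)) g            ∎

    neg-cong : ∀ {p q} → p ≈ᴾ q → -ᴾ p ≈ᴾ -ᴾ q
    neg-cong {p} {q} p≈q = ≈ᴾ-fromPairs λ e →
      trans (pair-neg p _) (trans (-‿cong (pairs p≈q e)) (sym (pair-neg q _)))

    inverseˡ : ∀ p → -ᴾ p ++ p ≈ᴾ []
    inverseˡ p = ≈ᴾ-byPairing λ g →
      trans (pair-++ (-ᴾ p) p g) (trans (+-congʳ (pair-neg p g)) (-‿inverseˡ _))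

    comm* : ∀ p q → p *ᴾ q ≈ᴾ q *ᴾ p
    comm* p q = ≈ᴾ-byPairing λ g → begin
      pair (p *ᴾ q) g                              ≈⟨ pair-*ᴾ p q g ⟩
      pair p (λ a → pair q (λ b → g (a ⊕ b)))      ≈⟨ pair-swap p q _ ⟩
      pair q (λ b → pair p (λ a → g (a ⊕ b)))      ≈⟨ pair-cong q (λ b → pair-cong p λ a →
                                                        reflexive (≡.cong g (⊕-comm a b))) ⟩
      pair q (λ b → pair p (λ a → g (b ⊕ a)))      ≈⟨ pair-*ᴾ q p g ⟨
      pair (q *ᴾ p) g                              ∎

    congˡ* : ∀ p {q q′} → q ≈ᴾ q′ → p *ᴾ q ≈ᴾ p *ᴾ q′
    congˡ* p {q} {q′} q≈ = ≈ᴾ-fromPairs λ e → begin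
      pair (p *ᴾ q) (kronecker e)                         ≈⟨ pair-*ᴾ p q _ ⟩
      pair p (λ a → pair q (λ b → kronecker e (a ⊕ b)))   ≈⟨ pair-cong p (λ a → pair-shift a e q≈) ⟩
      pair p (λ a → pair q′ (λ b → kronecker e (a ⊕ b)))  ≈⟨ pair-*ᴾ p q′ _ ⟨
      pair (p *ᴾ q′) (kronecker e)                        ∎

    cong* : ∀ {p p′ q q′} → p ≈ᴾ p′ → q ≈ᴾ q′ → p *ᴾ q ≈ᴾ p′ *ᴾ q′
    cong* {p} {p′} {q} {q′} p≈ q≈ =
      ≈ᴾ-trans (congˡ* p q≈) (≈ᴾ-trans (comm* p q′) (≈ᴾ-trans (congˡ* q′ p≈) (comm* q′ p′)))

    assoc* : ∀ p q r → (p *ᴾ q) *ᴾ r ≈ᴾ p *ᴾ (q *ᴾ r)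
    assoc* p q r = ≈ᴾ-byPairing λ g → begin
      pair ((p *ᴾ q) *ᴾ r) g
        ≈⟨ pair-*ᴾ (p *ᴾ q) r g ⟩
      pair (p *ᴾ q) (λ d → pair r (λ e → g (d ⊕ e)))
        ≈⟨ pair-*ᴾ p q _ ⟩
      pair p (λ a → pair q (λ b → pair r (λ e → g ((a ⊕ b) ⊕ e))))
        ≈⟨ pair-cong p (λ a → pair-cong q λ b → pair-cong r λ e →
             reflexive (≡.cong g (⊕-assoc a b e))) ⟩
      pair p (λ a → pair q (λ b → pair r (λ e → g (a ⊕ (b ⊕ e)))))
        ≈⟨ pair-cong p (λ a → pair-*ᴾ q r (λ d → g (a ⊕ d))) ⟨
      pair p (λ a → pair (q *ᴾ r) (λ d → g (a ⊕ d)))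
        ≈⟨ pair-*ᴾ p (q *ᴾ r) g ⟨
      pair (p *ᴾ (q *ᴾ r)) g
        ∎

    identityˡ* : ∀ p → monomial 𝟎 *ᴾ p ≈ᴾ p
    identityˡ* p = ≈ᴾ-byPairing λ g → begin
      pair (monomial 𝟎 *ᴾ p) g               ≈⟨ pair-*ᴾ (monomial 𝟎) p g ⟩
      1# * pair p (λ b → g (𝟎 ⊕ b)) + 0#     ≈⟨ +-identityʳ _ ⟩
      1# * pair p (λ b → g (𝟎 ⊕ b))          ≈⟨ *-identityˡ _ ⟩
      pair p (λ b → g (𝟎 ⊕ b))               ≈⟨ pair-cong p (λ b → reflexive (≡.cong g (⊕-identityˡ b))) ⟩
      pair p g                               ∎

    distribˡ* : ∀ p q r → p *ᴾ (q ++ r) ≈ᴾ p *ᴾ q ++ p *ᴾ r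
    distribˡ* p q r = ≈ᴾ-byPairing λ g → begin
      pair (p *ᴾ (q ++ r)) g                           ≈⟨ pair-*ᴾ p (q ++ r) g ⟩
      pair p (λ a → pair (q ++ r) (λ b → g (a ⊕ b)))   ≈⟨ pair-cong p (λ a → pair-++ q r _) ⟩
      pair p (λ a → pair q (λ b → g (a ⊕ b)) + pair r (λ b → g (a ⊕ b)))
                                                       ≈⟨ pair-+ p _ _ ⟩
      pair p (λ a → pair q (λ b → g (a ⊕ b))) + pair p (λ a → pair r (λ b → g (a ⊕ b)))
                                                       ≈⟨ +-cong (pair-*ᴾ p q g) (pair-*ᴾ p r g) ⟨
      pair (p *ᴾ q) g + pair (p *ᴾ r) g                ≈⟨ pair-++ (p *ᴾ q) (p *ᴾ r) g ⟨
      pair (p *ᴾ q ++ p *ᴾ r) g                        ∎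

  R[v] : CommutativeRing c ℓ
  R[v] = record
    { Carrier = Poly ; _≈_ = _≈ᴾ_ ; _+_ = _++_ ; _*_ = _*ᴾ_ ; -_ = -ᴾ_
    ; 0# = [] ; 1# = monomial 𝟎
    ; isCommutativeRing = record
      { isRing = record
        { +-isAbelianGroup = record
          { isGroup = record
            { isMonoid = record
              { isSemigroup = record
                { isMagma = record
                  { isEquivalence = record
                    { refl  = mk≈ᴾ λ _ → refl
                    ; sym   = λ p≈q → mk≈ᴾ λ e → sym (coeff-≈ p≈q e)
                    ; trans = ≈ᴾ-trans
                    }
                  ; ∙-cong = cong+
                  }
                ; assoc = assoc+
                }
              ; identity = (λ _ → mk≈ᴾ λ _ → refl) , (λ p → comm+ p [])
              }
            ; inverse = inverseˡ , (λ p → ≈ᴾ-trans (comm+ p (-ᴾ p)) (inverseˡ p))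
            ; ⁻¹-cong = neg-cong
            }
          ; comm = comm+
          }
        ; *-cong = cong*
        ; *-assoc = assoc*
        ; *-identity = identityˡ* , (λ p → ≈ᴾ-trans (comm* p _) (identityˡ* p))
        ; distrib = distribˡ* , (λ p q r → ≈ᴾ-trans (comm* (q ++ r) p)
            (≈ᴾ-trans (distribˡ* p q r) (cong+ (comm* p q) (comm* p r))))
        }
      ; *-comm = comm*
      }
    }

module StanleyReisner {c ℓ₁ ℓ₂} (𝐤 : HeytingField c ℓ₁ ℓ₂) (m : ℕ) where

  open Polynomials (HeytingCommutativeRing.commutativeRing
                     (HeytingField.heytingCommutativeRing 𝐤)) m
    renaming (R[v] to 𝐤[v]) public
  private module 𝐤 = HeytingField 𝐤

  HomogeneousPoly : Degree m → Pred Poly ℓ₁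
  HomogeneousPoly b p = ∀ e → e ≢ b → coeff p e 𝐤.≈ 𝐤.0#

  Nonfaces : Pred (Subset m) 0ℓ → Pred Poly c
  Nonfaces K p = ∃ λ τ → ¬ K τ × p ≡ v^ τ

  FaceRing : Pred (Subset m) 0ℓ → CommutativeRing c (c ⊔ ℓ₁)
  FaceRing K = quotientRing 𝐤[v] (Nonfaces K)

  FaceModule : Pred (Subset m) 0ℓ → Module 𝐤[v] c (c ⊔ ℓ₁)
  FaceModule K = quotientModule 𝐤[v] (Nonfaces K)

  -- A class is homogeneous of degree b if it has a representative that is.
  HomogeneousFace : ∀ K → Degree m → Pred (Module.Carrierᴹ (FaceModule K)) (c ⊔ ℓ₁)
  HomogeneousFace K b p = ∃ λ q → HomogeneousPoly b q × Module._≈ᴹ_ (FaceModule K) p q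

  -- A finitely generated ℕ^m-graded free module ⨁ₐ 𝐤[v](-a)^βₐ is given
  -- by the list of the degrees a of its generators, each repeated βₐ times.
  GradedFree : Set
  GradedFree = List (Degree m)

  Free : GradedFree → Module 𝐤[v] c ℓ₁
  Free as = freeModule 𝐤[v] (length as)

  -- An element v^e of the summand 𝐤[v](-a) has degree e ⊕ a.
  HomogeneousFree : ∀ as → Degree m → Pred (Module.Carrierᴹ (Free as)) ℓ₁
  HomogeneousFree as b x = ∀ j e → e ⊕ List.lookup as j ≢ b → coeff (x j) e 𝐤.≈ 𝐤.0#

  multiplicity : Degree m → GradedFree → ℕ
  multiplicity a as = length (filter (_≟ᵈ a) as)

  Variables : Pred Poly c
  Variables p = ∃ λ i → p ≡ var i

  -- The complex 0 ← 𝐤(K) ← F 0 ← ⋯ ← F h ← 0 is continued by zero modules,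
  -- so that exactness at F h says that the map out of F h is injective.
  record MinimalFreeResolution (K : Pred (Subset m) 0ℓ) : Set (c ⊔ ℓ₁) where
    field
      h : ℕ
      F : ℕ → GradedFree
      d : ∀ i → Module.Carrierᴹ (Free (F (suc i))) → Module.Carrierᴹ (Free (F i))
      ε : Module.Carrierᴹ (Free (F 0)) → Module.Carrierᴹ (FaceModule K)

    private
      module M = Module (FaceModule K)
      module Fᵐ i = Module (Free (F i))

    field
      F-nonzero : F h ≢ []
      F-zero    : ∀ i → h ℕ.< i → F i ≡ []

      d-linear : ∀ i → IsModuleHomomorphism (Fᵐ.rawModule (suc i)) (Fᵐ.rawModule i) (d i)
      ε-linear : IsModuleHomomorphism (Fᵐ.rawModule 0) M.rawModule ε

      d-graded : ∀ i b x → HomogeneousFree (F (suc i)) b x → HomogeneousFree (F i) b (d i x)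
      ε-graded : ∀ b x → HomogeneousFree (F 0) b x → HomogeneousFace K b (ε x)

      ε-surjective : ∀ y → ∃ λ x → ε x M.≈ᴹ y

      ε∘d≈0   : ∀ x → ε (d 0 x) M.≈ᴹ M.0ᴹ
      exact-0 : ∀ x → ε x M.≈ᴹ M.0ᴹ → ∃ λ y → Fᵐ._≈ᴹ_ 0 (d 0 y) x

      d∘d≈0 : ∀ i x → Fᵐ._≈ᴹ_ i (d i (d (suc i) x)) (Fᵐ.0ᴹ i)
      exact : ∀ i x → Fᵐ._≈ᴹ_ i (d i x) (Fᵐ.0ᴹ i) →
              ∃ λ y → Fᵐ._≈ᴹ_ (suc i) (d (suc i) y) x

      -- The image of d i lies in 𝔪 F i, where 𝔪 = ⟨v₁,…,vₘ⟩.
      minimal : ∀ i x j → ⟨ 𝐤[v] ⟩ Variables (d i x j)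

    β : ℕ → Subset m → ℕ
    β i a = multiplicity (indicator a) (F i)

{-# OPTIONS --safe #-}
module Submission where

-- Minimality plays no role. The degree-b part of a free resolution of 𝐤(K) is an
-- exact complex of finite-dimensional 𝐤-spaces, in which the i-th space has one basis
-- vector per generator of F i whose degree divides v^b, and which resolves 𝐤 or 0
-- according to whether b is a face. Its Euler characteristic modulo 2 therefore equals
-- f b, so f is a sum of indicator functions of upward closed sets [g, →), one for each
-- generator degree g. The Möbius transform of such a function is δ_g if g is squarefree
-- and 0 otherwise.

open import Defs
open import Level using (_⊔_; 0ℓ) renaming (suc to lsuc)
open import Algebra.Apartness.Bundles using (HeytingCommutativeRing; HeytingField)
open import Algebra.Apartness.Properties.HeytingCommutativeRing using (1#0; x-0≈x)
open import Algebra.Bundles using (CommutativeMonoid; CommutativeRing)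
open import Algebra.Definitions using (LeftInvertible)
open import Algebra.Module.Bundles using (LeftSemimodule; Module)
import Algebra.Module.Construct.TensorUnit as TensorUnit
open import Algebra.Module.Morphism.Structures using (IsModuleHomomorphism)
import Algebra.Properties.CommutativeSemigroup as CommutativeSemigroupProperties
import Algebra.Properties.Group as GroupProperties
import Algebra.Properties.Ring as RingProperties
open import Data.Bool.Base using (Bool; true; false; if_then_else_)
open import Data.Fin.Base using (Fin; zero; suc)
open import Data.Fin.Subset using (Subset; inside; outside; _⊆_)
open import Data.Fin.Subset.Properties using (_⊆?_; out⊆; s⊆s)
open import Data.List.Base as List using (List; []; _∷_; _++_; filter; foldr; length; map; upTo)
open import Data.List.Properties using (map-++; map-∘; map-cong; upTo-∷ʳ)
open import Data.Nat.Base as ℕ using (ℕ; zero; suc; 2+; parity; NonZero)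
import Data.Nat.Properties as ℕ
open import Data.Parity.Base as ℙ using (Parity; 0ℙ; 1ℙ)
import Data.Parity.Properties as ℙ
open import Data.Product.Base using (∃; _×_; _,_; proj₁)
open import Data.Sum.Base using (_⊎_; inj₁; inj₂; [_,_]′)
open import Data.Vec.Base using ([]; _∷_)
open import Data.Vec.Functional as Vector using (Vector)
import Data.Vec.Properties as Vec
open import Function.Base using (id)
open import Function.Bundles using (mk⇔)
open import Relation.Binary.PropositionalEquality as ≡ using (_≡_; _≢_)
import Relation.Binary.Reasoning.Setoid as SetoidReasoning
open import Relation.Nullary using (¬_; does; yes; no; contradiction)
open import Relation.Nullary.Decidable using (dec-true; dec-false; does-⇔)
open import Relation.Unary using (Pred; Decidable)

-- The obstacle is the field: it has an apartness relation but no test for `x ≈ 0#`, so pivots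
-- cannot be searched for, and a subspace cut out by equations need not have a computable dimension.
-- Dimensions are therefore produced along the resolution. Whether `b` is a face is read off the
-- parity `f b`, and this gives the cycles in `F 0` a dimension. By exactness the cycles at one
-- index are the image of the next map, and rank-nullity then yields the dimension of the cycles at
-- the next index. Each rank is a sum of two consecutive cycle dimensions, so modulo 2 the sum of
-- the ranks telescopes. Exactness is given for whole modules, so a preimage of a homogeneous
-- element need not be homogeneous. Projections onto degree parts that commute with the
-- differentials repair this.

-- Sums modulo 2 and the Möbius transform of upward closed sets.

module ParitySums where
  open ≡ using (refl; sym; trans; cong; cong₂)
  open ≡.≡-Reasoning
  open CommutativeSemigroupProperties
    (CommutativeMonoid.commutativeSemigroup ℙ.+-0-commutativeMonoid) using (interchange)

  ∑ℙ : List Parity → Parity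
  ∑ℙ = foldr ℙ._+_ 0ℙ

  ∑ℙ-++ : ∀ ps qs → ∑ℙ (ps ++ qs) ≡ ∑ℙ ps ℙ.+ ∑ℙ qs
  ∑ℙ-++ []       qs = refl
  ∑ℙ-++ (p ∷ ps) qs = trans (cong (p ℙ.+_) (∑ℙ-++ ps qs)) (sym (ℙ.+-assoc p _ _))

  module _ {a} {A : Set a} where

    ∑ℙ-map-0 : ∀ (xs : List A) → ∑ℙ (map (λ _ → 0ℙ) xs) ≡ 0ℙ
    ∑ℙ-map-0 []       = refl
    ∑ℙ-map-0 (x ∷ xs) = ∑ℙ-map-0 xs

    ∑ℙ-map-+ : ∀ (f g : A → Parity) xs →
               ∑ℙ (map (λ x → f x ℙ.+ g x) xs) ≡ ∑ℙ (map f xs) ℙ.+ ∑ℙ (map g xs)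
    ∑ℙ-map-+ f g []       = refl
    ∑ℙ-map-+ f g (x ∷ xs) =
      trans (cong (f x ℙ.+ g x ℙ.+_) (∑ℙ-map-+ f g xs)) (interchange (f x) _ _ _)

    ∑ℙ-filter : ∀ {p} {P : Pred A p} (P? : Decidable P) (f : A → Parity) xs →
                ∑ℙ (map f (filter P? xs)) ≡ ∑ℙ (map (λ x → if does (P? x) then f x else 0ℙ) xs)
    ∑ℙ-filter P? f []       = refl
    ∑ℙ-filter P? f (x ∷ xs) with does (P? x)
    ... | true  = cong (f x ℙ.+_) (∑ℙ-filter P? f xs)
    ... | false = ∑ℙ-filter P? f xs

    ∑-pointwise : ∀ {m} (g : A → 2^[_]*.Carrier m) xs b → ∑ (map g xs) b ≡ ∑ℙ (map (λ x → g x b) xs)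
    ∑-pointwise g []       b = refl
    ∑-pointwise g (x ∷ xs) b = cong (g x b ℙ.+_) (∑-pointwise g xs b)

  ∑ℙ-subsets : ∀ {m} (f : Subset (suc m) → Parity) →
    ∑ℙ (map f (subsets (suc m))) ≡
    ∑ℙ (map (λ b → f (outside ∷ b)) (subsets m)) ℙ.+ ∑ℙ (map (λ b → f (inside ∷ b)) (subsets m))
  ∑ℙ-subsets {m} f = begin
    ∑ℙ (map f (out ++ ins))                ≡⟨ cong ∑ℙ (map-++ f out ins) ⟩
    ∑ℙ (map f out ++ map f ins)            ≡⟨ ∑ℙ-++ (map f out) (map f ins) ⟩
    ∑ℙ (map f out) ℙ.+ ∑ℙ (map f ins)
      ≡⟨ cong₂ (λ ps qs → ∑ℙ ps ℙ.+ ∑ℙ qs) (map-∘ (subsets m)) (map-∘ (subsets m)) ⟨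
    ∑ℙ (map (λ b → f (outside ∷ b)) (subsets m)) ℙ.+ ∑ℙ (map (λ b → f (inside ∷ b)) (subsets m)) ∎
    where
    out = map (outside ∷_) (subsets m)
    ins = map (inside ∷_) (subsets m)

  ∑-·δ : ∀ {m} (c : Subset m → Parity) → 2^[_]*._≈_ m (∑ (map (λ a → c a · δ a) (subsets m))) c
  ∑-·δ {m} c b = trans (∑-pointwise (λ a → c a · δ a) (subsets m) b) (select c b)
    where
    select : ∀ {m} (c : Subset m → Parity) b → ∑ℙ (map (λ a → (c a · δ a) b) (subsets m)) ≡ c b
    -- This is the half of the sum over subsets whose first bit differs from that of `b`: there `δ`
    -- computes to `0ℙ`.
    off : ∀ {m} (c : Subset m → Parity) → ∑ℙ (map (λ a → c a ℙ.* 0ℙ) (subsets m)) ≡ 0ℙ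
    off {m} c = trans (cong ∑ℙ (map-cong (λ a → ℙ.*-zeroʳ (c a)) (subsets m))) (∑ℙ-map-0 (subsets m))
    select c []            = trans (ℙ.+-identityʳ _) (ℙ.*-identityʳ _)
    select c (outside ∷ b) = trans (∑ℙ-subsets (λ a → (c a · δ a) (outside ∷ b)))
      (trans (cong₂ ℙ._+_ (select _ b) (off (λ a → c (inside ∷ a)))) (ℙ.+-identityʳ _))
    select c (inside ∷ b)  = trans (∑ℙ-subsets (λ a → (c a · δ a) (inside ∷ b)))
      (cong₂ ℙ._+_ (off (λ a → c (outside ∷ a))) (select _ b))

  ℳ-cong : ∀ {m} {f g : 2^[_]*.Carrier m} a → (∀ b → f b ≡ g b) → ℳ f a ≡ ℳ g a
  ℳ-cong {m} a f≗g = cong ∑ℙ (map-cong f≗g (filter (_⊆? a) (subsets m)))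

  ℳ-0 : ∀ {m} (a : Subset m) → ℳ (λ _ → 0ℙ) a ≡ 0ℙ
  ℳ-0 {m} a = ∑ℙ-map-0 (filter (_⊆? a) (subsets m))

  ℳ-∑ℙ : ∀ {m i} {I : Set i} (f : I → 2^[_]*.Carrier m) is a →
         ℳ (λ b → ∑ℙ (map (λ i → f i b) is)) a ≡ ∑ℙ (map (λ i → ℳ (f i) a) is)
  ℳ-∑ℙ     f []       a = ℳ-0 a
  ℳ-∑ℙ {m} f (i ∷ is) a = trans
    (∑ℙ-map-+ (f i) (λ b → ∑ℙ (map (λ i → f i b) is)) (filter (_⊆? a) (subsets m)))
    (cong (ℳ (f i) a ℙ.+_) (ℳ-∑ℙ f is a))

  ℳ-outside : ∀ {m} (f : 2^[_]*.Carrier (suc m)) a → ℳ f (outside ∷ a) ≡ ℳ (λ b → f (outside ∷ b)) a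
  ℳ-outside {m} f a = begin
    ℳ f (outside ∷ a)
      ≡⟨ ∑ℙ-filter (_⊆? (outside ∷ a)) f (subsets (suc m)) ⟩
    ∑ℙ (map (λ b → if does (b ⊆? (outside ∷ a)) then f b else 0ℙ) (subsets (suc m)))
      -- The inclusion test computes on the first bit: `inside ∷ b` never lies in `outside ∷ a`, so
      -- the second half is a sum of zeros.
      ≡⟨ ∑ℙ-subsets (λ b → if does (b ⊆? (outside ∷ a)) then f b else 0ℙ) ⟩
    ∑ℙ (map (λ b → if does (b ⊆? a) then f (outside ∷ b) else 0ℙ) (subsets m)) ℙ.+ ∑ℙ (map (λ _ → 0ℙ) (subsets m))
      ≡⟨ cong₂ ℙ._+_ (sym (∑ℙ-filter (_⊆? a) (λ b → f (outside ∷ b)) (subsets m))) (∑ℙ-map-0 (subsets m)) ⟩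
    ℳ (λ b → f (outside ∷ b)) a ℙ.+ 0ℙ
      ≡⟨ ℙ.+-identityʳ _ ⟩
    ℳ (λ b → f (outside ∷ b)) a
      ∎

  ℳ-inside : ∀ {m} (f : 2^[_]*.Carrier (suc m)) a →
    ℳ f (inside ∷ a) ≡ ℳ (λ b → f (outside ∷ b)) a ℙ.+ ℳ (λ b → f (inside ∷ b)) a
  ℳ-inside {m} f a = begin
    ℳ f (inside ∷ a)
      ≡⟨ ∑ℙ-filter (_⊆? (inside ∷ a)) f (subsets (suc m)) ⟩
    ∑ℙ (map (λ b → if does (b ⊆? (inside ∷ a)) then f b else 0ℙ) (subsets (suc m)))
      ≡⟨ ∑ℙ-subsets (λ b → if does (b ⊆? (inside ∷ a)) then f b else 0ℙ) ⟩
    ∑ℙ (map (λ b → if does (b ⊆? a) then f (outside ∷ b) else 0ℙ) (subsets m)) ℙ.+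
    ∑ℙ (map (λ b → if does (b ⊆? a) then f (inside ∷ b) else 0ℙ) (subsets m))
      ≡⟨ cong₂ ℙ._+_ (∑ℙ-filter (_⊆? a) (λ b → f (outside ∷ b)) (subsets m))
                     (∑ℙ-filter (_⊆? a) (λ b → f (inside ∷ b)) (subsets m)) ⟨
    ℳ (λ b → f (outside ∷ b)) a ℙ.+ ℳ (λ b → f (inside ∷ b)) a
      ∎

  iverson : Bool → Parity
  iverson b = if b then 1ℙ else 0ℙ

  upset : ∀ {m} → Degree m → 2^[_]*.Carrier m
  upset g b = iverson (does (subtract? g (indicator b)))

  upset-0∷ : ∀ {m} (g : Degree m) x b → upset (0 ∷ g) (x ∷ b) ≡ upset g b
  upset-0∷ g x b with subtract? g (indicator b)
  ... | yes _ = refl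
  ... | no  _ = refl

  upset-1∷ : ∀ {m} (g : Degree m) b → upset (1 ∷ g) (inside ∷ b) ≡ upset g b
  upset-1∷ g b with subtract? g (indicator b)
  ... | yes _ = refl
  ... | no  _ = refl

  -- The b between g and a form a Boolean interval, of even size unless g = a.
  ℳ-upset : ∀ {m} (g : Degree m) (a : Subset m) → ℳ (upset g) a ≡ iverson (does (g ≟ᵈ indicator a))
  ℳ-upset []              []            = refl
  ℳ-upset (zero ∷ g)      (outside ∷ a) = trans (ℳ-outside (upset (0 ∷ g)) a)
    (trans (ℳ-cong a (upset-0∷ g outside)) (ℳ-upset g a))
  ℳ-upset (suc x ∷ g)     (outside ∷ a) = trans (ℳ-outside (upset (suc x ∷ g)) a) (ℳ-0 a)
  ℳ-upset (zero ∷ g)      (inside ∷ a)  = trans (ℳ-inside (upset (0 ∷ g)) a)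
    (trans (cong₂ ℙ._+_ (ℳ-cong a (upset-0∷ g outside)) (ℳ-cong a (upset-0∷ g inside)))
           (ℙ.p+p≡0ℙ (ℳ (upset g) a)))
  ℳ-upset (1 ∷ g)         (inside ∷ a)  = trans (ℳ-inside (upset (1 ∷ g)) a)
    (cong₂ ℙ._+_ (ℳ-0 a) (trans (ℳ-cong a (upset-1∷ g)) (ℳ-upset g a)))
  ℳ-upset (2+ x ∷ g)      (inside ∷ a)  = trans (ℳ-inside (upset (2+ x ∷ g)) a)
    (cong₂ ℙ._+_ (ℳ-0 a) (ℳ-0 a))

  -- The dimension of the degree-e piece of the free module with generators in degrees as.
  rankAt : ∀ {m} → Degree m → List (Degree m) → ℕ
  rankAt e as = length (filter (λ a → subtract? a e) as)

  parity-length-filter : ∀ {a p} {A : Set a} {P : Pred A p} (P? : Decidable P) xs →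
    parity (length (filter P? xs)) ≡ ∑ℙ (map (λ x → iverson (does (P? x))) xs)
  parity-length-filter P? []       = refl
  parity-length-filter P? (x ∷ xs) with does (P? x)
  ... | true  = trans (ℙ.+-homo-+ 1 (length (filter P? xs))) (cong (1ℙ ℙ.+_) (parity-length-filter P? xs))
  ... | false = parity-length-filter P? xs

  ℳ-rankAt : ∀ {m} (as : List (Degree m)) a →
    ℳ (λ b → parity (rankAt (indicator b) as)) a ≡ parity (length (filter (_≟ᵈ indicator a) as))
  ℳ-rankAt as a = begin
    ℳ (λ b → parity (rankAt (indicator b) as)) a
      ≡⟨ ℳ-cong a (λ b → parity-length-filter (λ g → subtract? g (indicator b)) as) ⟩
    ℳ (λ b → ∑ℙ (map (λ g → upset g b) as)) a
      ≡⟨ ℳ-∑ℙ upset as a ⟩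
    ∑ℙ (map (λ g → ℳ (upset g) a) as)
      ≡⟨ cong ∑ℙ (map-cong (λ g → ℳ-upset g a) as) ⟩
    ∑ℙ (map (λ g → iverson (does (g ≟ᵈ indicator a))) as)
      ≡⟨ parity-length-filter (_≟ᵈ indicator a) as ⟨
    parity (length (filter (_≟ᵈ indicator a) as))
      ∎

  ∑ℙ-upTo-suc : ∀ (g : ℕ → Parity) n → ∑ℙ (map g (upTo (suc n))) ≡ ∑ℙ (map g (upTo n)) ℙ.+ g n
  ∑ℙ-upTo-suc g n = begin
    ∑ℙ (map g (upTo (suc n)))               ≡⟨ cong (λ is → ∑ℙ (map g is)) (upTo-∷ʳ n) ⟨
    ∑ℙ (map g (upTo n ++ n ∷ []))           ≡⟨ cong ∑ℙ (map-++ g (upTo n) (n ∷ [])) ⟩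
    ∑ℙ (map g (upTo n) ++ g n ∷ [])         ≡⟨ ∑ℙ-++ (map g (upTo n)) (g n ∷ []) ⟩
    ∑ℙ (map g (upTo n)) ℙ.+ (g n ℙ.+ 0ℙ)    ≡⟨ cong (∑ℙ (map g (upTo n)) ℙ.+_) (ℙ.+-identityʳ (g n)) ⟩
    ∑ℙ (map g (upTo n)) ℙ.+ g n             ∎

open ParitySums

-- Dimension and rank-nullity over a nontrivial local ring.

module _ {c ℓ} (K : CommutativeRing c ℓ) where
  open CommutativeRing K

  Nontrivial : Set ℓ
  Nontrivial = ¬ 1# ≈ 0#

  -- This replaces the case distinction "zero or invertible": of two scalars with sum 1, one can be
  -- chosen that is invertible.
  Local : Set (c ⊔ ℓ)
  Local = ∀ {x y} → x + y ≈ 1# → LeftInvertible _≈_ 1# _*_ x ⊎ LeftInvertible _≈_ 1# _*_ y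

module LinearAlgebra {c ℓ} (K : CommutativeRing c ℓ) (1≉0 : Nontrivial K) (local : Local K) where

  open CommutativeRing K
  open RingProperties ring using (-‿distribˡ-*; -‿distribʳ-*; -‿+-comm)

  -- Over a ring a semimodule already has negatives, namely `(- 1#) *ₗ x`; subtraction appears below
  -- as `x +ᴹ (- r) *ₗ u`.
  Space : Set (lsuc (c ⊔ ℓ))
  Space = LeftSemimodule semiring c ℓ

  private module S (V : Space) = LeftSemimodule V

  -- A level closed under Ker, so that HasDim can vary the subset.
  SubsetOf : Space → Set (lsuc (c ⊔ ℓ))
  SubsetOf V = Pred (S.Carrierᴹ V) (c ⊔ ℓ)

  scalars : Space
  scalars = TensorUnit.leftSemimodule

  record IsLinear (V W : Space) (φ : S.Carrierᴹ V → S.Carrierᴹ W) : Set (c ⊔ ℓ) where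
    private
      module V = LeftSemimodule V
      module W = LeftSemimodule W
    field
      ⟦⟧-cong : ∀ {x y} → x V.≈ᴹ y → φ x W.≈ᴹ φ y
      +-homo  : ∀ x y → φ (x V.+ᴹ y) W.≈ᴹ φ x W.+ᴹ φ y
      *-homo  : ∀ r x → φ (r V.*ₗ x) W.≈ᴹ r W.*ₗ φ x

    0-homo : φ V.0ᴹ W.≈ᴹ W.0ᴹ
    0-homo = begin
      φ V.0ᴹ             ≈⟨ ⟦⟧-cong (V.*ₗ-zeroˡ V.0ᴹ) ⟨
      φ (0# V.*ₗ V.0ᴹ)   ≈⟨ *-homo 0# V.0ᴹ ⟩
      0# W.*ₗ φ V.0ᴹ     ≈⟨ W.*ₗ-zeroˡ _ ⟩
      W.0ᴹ               ∎
      where open SetoidReasoning W.≈ᴹ-setoid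

    +*-homo : ∀ x r y → φ (x V.+ᴹ r V.*ₗ y) W.≈ᴹ φ x W.+ᴹ r W.*ₗ φ y
    +*-homo x r y = W.≈ᴹ-trans (+-homo x _) (W.+ᴹ-cong W.≈ᴹ-refl (*-homo r y))

  open IsLinear

  id-linear : ∀ {V} → IsLinear V V id
  id-linear {V} = record
    { ⟦⟧-cong = id ; +-homo = λ _ _ → S.≈ᴹ-refl V ; *-homo = λ _ _ → S.≈ᴹ-refl V }

  ∘-linear : ∀ {U V W φ ψ} → IsLinear V W ψ → IsLinear U V φ → IsLinear U W (λ x → ψ (φ x))
  ∘-linear {W = W} Ψ Φ = record
    { ⟦⟧-cong = λ p → ⟦⟧-cong Ψ (⟦⟧-cong Φ p)
    ; +-homo  = λ x y → S.≈ᴹ-trans W (⟦⟧-cong Ψ (+-homo Φ x y)) (+-homo Ψ _ _)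
    ; *-homo  = λ r x → S.≈ᴹ-trans W (⟦⟧-cong Ψ (*-homo Φ r x)) (*-homo Ψ _ _)
    }

  record IsSubspace (V : Space) (P : SubsetOf V) : Set (c ⊔ ℓ) where
    private module V = LeftSemimodule V
    field
      +ᴹ-closed : ∀ {x y} → P x → P y → P (x V.+ᴹ y)
      *ₗ-closed : ∀ r {x} → P x → P (r V.*ₗ x)

  open IsSubspace

  Ker : ∀ V W → (S.Carrierᴹ V → S.Carrierᴹ W) → SubsetOf V → SubsetOf V
  Ker V W φ P x = P x × S._≈ᴹ_ W (φ x) (S.0ᴹ W)

  Ker-isSubspace : ∀ {V W φ P} → IsLinear V W φ → IsSubspace V P → IsSubspace V (Ker V W φ P)
  Ker-isSubspace {V} {W} Φ P-sub = record
    { +ᴹ-closed = λ (px , φx) (py , φy) → +ᴹ-closed P-sub px py ,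
        W.≈ᴹ-trans (+-homo Φ _ _) (W.≈ᴹ-trans (W.+ᴹ-cong φx φy) (W.+ᴹ-identityˡ _))
    ; *ₗ-closed = λ r (px , φx) → *ₗ-closed P-sub r px ,
        W.≈ᴹ-trans (*-homo Φ r _) (W.≈ᴹ-trans (W.*ₗ-cong refl φx) (W.*ₗ-zeroʳ r))
    }
    where module W = LeftSemimodule W

  -- A flag of hyperplane sections: unlike a basis, it restricts to kernels
  -- and pulls back along linear maps without any choice of coordinates.
  data HasDim (V : Space) (P : SubsetOf V) : ℕ → Set (c ⊔ ℓ) where
    trivial    : (∀ {x} → P x → S._≈ᴹ_ V x (S.0ᴹ V)) → HasDim V P 0
    hyperplane : ∀ {n μ u} → IsLinear V scalars μ → P u → μ u ≈ 1# →
                 HasDim V (Ker V scalars μ P) n → HasDim V P (suc n)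

  -- Each functional of the flag is precomposed with `φ` and each `u` is lifted to a preimage.
  -- Surjectivity passes to the hyperplane sections because `μ (φ x) ≈ μ y`; injectivity matters
  -- only once the flag is exhausted.
  HasDim-pullback : ∀ {V W φ P Q n} → IsLinear V W φ →
    (∀ {x} → P x → Q (φ x)) →
    (∀ {x} → P x → S._≈ᴹ_ W (φ x) (S.0ᴹ W) → S._≈ᴹ_ V x (S.0ᴹ V)) →
    (∀ {y} → Q y → ∃ λ x → P x × S._≈ᴹ_ W (φ x) y) →
    HasDim W Q n → HasDim V P n
  HasDim-pullback Φ into inj surj (trivial Q≈0) = trivial λ px → inj px (Q≈0 (into px))
  HasDim-pullback {V} {W} {φ} {P} {Q} Φ into inj surj (hyperplane {μ = μ} M qu μu≈1 D)
    with surj qu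
  ... | u′ , pu′ , φu′≈u =
    hyperplane (∘-linear M Φ) pu′ (trans (⟦⟧-cong M φu′≈u) μu≈1)
      (HasDim-pullback {Q = Ker W scalars μ Q} Φ
        (λ (px , z) → into px , z) (λ (px , _) → inj px) surj′ D)
    where
    surj′ : ∀ {y} → Ker W scalars μ Q y → ∃ λ x → Ker V scalars (λ x → μ (φ x)) P x × S._≈ᴹ_ W (φ x) y
    surj′ (qy , μy≈0) with surj qy
    ... | x , px , φx≈y = x , (px , trans (⟦⟧-cong M φx≈y) μy≈0) , φx≈y

  HasDim-resp : ∀ {V P Q n} → (∀ {x} → P x → Q x) → (∀ {x} → Q x → P x) →
                HasDim V Q n → HasDim V P n
  HasDim-resp {V} {P} {Q} P⊆Q Q⊆P =
    HasDim-pullback {P = P} {Q} id-linear P⊆Q (λ _ → id) (λ qy → _ , Q⊆P qy , S.≈ᴹ-refl V)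

  module _ {V : Space} where
    open LeftSemimodule V

    -- When `μ u ≈ 1#`, this map is the projection onto the kernel of `μ` along `u`.
    project-linear : ∀ {μ} u → IsLinear V scalars μ →
                     IsLinear V V (λ x → x +ᴹ (- μ x) *ₗ u)
    project-linear {μ} u M = record
      { ⟦⟧-cong = λ p → +ᴹ-cong p (*ₗ-cong (-‿cong (⟦⟧-cong M p)) ≈ᴹ-refl)
      ; +-homo  = λ x y → begin
          (x +ᴹ y) +ᴹ (- μ (x +ᴹ y)) *ₗ u             ≈⟨ +ᴹ-cong ≈ᴹ-refl (*ₗ-cong (neg-+ x y) ≈ᴹ-refl) ⟩
          (x +ᴹ y) +ᴹ (- μ x + - μ y) *ₗ u            ≈⟨ +ᴹ-cong ≈ᴹ-refl (*ₗ-distribʳ _ _ _) ⟩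
          (x +ᴹ y) +ᴹ ((- μ x) *ₗ u +ᴹ (- μ y) *ₗ u)  ≈⟨ interchange x y _ _ ⟩
          (x +ᴹ (- μ x) *ₗ u) +ᴹ (y +ᴹ (- μ y) *ₗ u)  ∎
      ; *-homo  = λ r x → begin
          r *ₗ x +ᴹ (- μ (r *ₗ x)) *ₗ u  ≈⟨ +ᴹ-cong ≈ᴹ-refl (*ₗ-cong (neg-* r x) ≈ᴹ-refl) ⟩
          r *ₗ x +ᴹ (r * - μ x) *ₗ u     ≈⟨ +ᴹ-cong ≈ᴹ-refl (*ₗ-assoc _ _ _) ⟩
          r *ₗ x +ᴹ r *ₗ ((- μ x) *ₗ u)  ≈⟨ *ₗ-distribˡ _ _ _ ⟨
          r *ₗ (x +ᴹ (- μ x) *ₗ u)       ∎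
      }
      where
      open SetoidReasoning ≈ᴹ-setoid
      open CommutativeSemigroupProperties
        (CommutativeMonoid.commutativeSemigroup +ᴹ-commutativeMonoid) using (interchange)
      neg-+ : ∀ x y → - μ (x +ᴹ y) ≈ - μ x + - μ y
      neg-+ x y = trans (-‿cong (+-homo M x y)) (sym (-‿+-comm _ _))
      neg-* : ∀ r x → - μ (r *ₗ x) ≈ r * - μ x
      neg-* r x = trans (-‿cong (*-homo M r x)) (-‿distribʳ-* r (μ x))

    private
      x+-x*1≈0 : ∀ {x y} → y ≈ 1# → x + - x * y ≈ 0#
      x+-x*1≈0 {x} y≈1 =
        trans (+-congˡ (trans (*-congˡ y≈1) (*-identityʳ _))) (-‿inverseʳ x)

    -- An exchange argument between the new functional `ν` and the first functional `μ` of the flag.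
    -- The vector `w`, which is `v` projected into the kernel of `μ`, satisfies
    -- `ν w + μ v * ν u ≈ 1#`. By locality either `ν w` is invertible, and induction applies inside
    -- the kernel of `μ`, or `ν u` is invertible, and `u` is a common complement of both kernels.
    Ker-functional-dim : ∀ {P n μ v} → IsSubspace V P → HasDim V P n →
      IsLinear V scalars μ → P v → μ v ≈ 1# →
      ∃ λ n′ → n ≡ suc n′ × HasDim V (Ker V scalars μ P) n′
    Ker-functional-dim P-sub (trivial P≈0) M pv μv≈1 =
      contradiction (trans (sym μv≈1) (trans (⟦⟧-cong M (P≈0 pv)) (0-homo M))) 1≉0
    Ker-functional-dim {P} {μ = ν} {v} P-sub (hyperplane {n} {μ} {u} M pu μu≈1 D) N pv νv≈1 =
      [ through-w , through-u ]′ (local split)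
      where
      open SetoidReasoning setoid
      w = v +ᴹ (- μ v) *ₗ u

      split : ν w + μ v * ν u ≈ 1#
      split = begin
        ν w + μ v * ν u                  ≈⟨ +-congʳ (+*-homo N v (- μ v) u) ⟩
        (ν v + - μ v * ν u) + μ v * ν u  ≈⟨ +-assoc _ _ _ ⟩
        ν v + (- μ v * ν u + μ v * ν u)  ≈⟨ +-congˡ (distribʳ _ _ _) ⟨
        ν v + (- μ v + μ v) * ν u        ≈⟨ +-congˡ (*-congʳ (-‿inverseˡ _)) ⟩
        ν v + 0# * ν u                   ≈⟨ +-congˡ (zeroˡ _) ⟩
        ν v + 0#                         ≈⟨ +-identityʳ _ ⟩
        ν v                              ≈⟨ νv≈1 ⟩
        1#                               ∎

      through-w : LeftInvertible _≈_ 1# _*_ (ν w) → _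
      through-w (s , sνw≈1)
        with Ker-functional-dim (Ker-isSubspace M P-sub) D N (p-w′ , μw′≈0) νw′≈1
        where
        p-w′ : P (s *ₗ w)
        p-w′ = *ₗ-closed P-sub s (+ᴹ-closed P-sub pv (*ₗ-closed P-sub _ pu))
        μw′≈0 : μ (s *ₗ w) ≈ 0#
        μw′≈0 = trans (*-homo M s w)
          (trans (*-congˡ (trans (+*-homo M v _ u) (x+-x*1≈0 μu≈1))) (zeroʳ s))
        νw′≈1 : ν (s *ₗ w) ≈ 1#
        νw′≈1 = trans (*-homo N s w) sνw≈1
      ... | n′ , ≡.refl , D′ = n , ≡.refl ,
        hyperplane M (p-t , νt≈0) μt≈1
          (HasDim-resp (λ ((p , l) , m) → (p , m) , l) (λ ((p , m) , l) → (p , l) , m) D′)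
        where
        -- `u` is moved into the kernel of `ν` along `s *ₗ w`. As `μ w ≈ 0#`, the value `μ u ≈ 1#`
        -- survives, so `μ` can be the first functional of the flag on the kernel of `ν`; the two
        -- sections are then swapped.
        t = u +ᴹ (- ν u) *ₗ (s *ₗ w)
        p-t : P t
        p-t = +ᴹ-closed P-sub pu (*ₗ-closed P-sub _ (*ₗ-closed P-sub s
          (+ᴹ-closed P-sub pv (*ₗ-closed P-sub _ pu))))
        νt≈0 : ν t ≈ 0#
        νt≈0 = trans (+*-homo N u _ _) (x+-x*1≈0 (trans (*-homo N s w) sνw≈1))
        μt≈1 : μ t ≈ 1#
        μt≈1 = begin
          μ t                       ≈⟨ +*-homo M u _ _ ⟩
          μ u + - ν u * μ (s *ₗ w)  ≈⟨ +-congˡ (*-congˡ (*-homo M s w)) ⟩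
          μ u + - ν u * (s * μ w)   ≈⟨ +-congˡ (*-congˡ (*-congˡ (trans (+*-homo M v _ u) (x+-x*1≈0 μu≈1)))) ⟩
          μ u + - ν u * (s * 0#)    ≈⟨ +-congˡ (*-congˡ (zeroʳ s)) ⟩
          μ u + - ν u * 0#          ≈⟨ +-congˡ (zeroʳ _) ⟩
          μ u + 0#                  ≈⟨ +-identityʳ _ ⟩
          μ u                       ≈⟨ μu≈1 ⟩
          1#                        ∎

      -- Both kernels are complements of u, hence isomorphic along the projection off u.
      through-u : LeftInvertible _≈_ 1# _*_ (μ v * ν u) → _
      through-u (s , sμvνu≈1) = n , ≡.refl ,
        HasDim-pullback (project-linear u M) into inj surj D
        where
        module ᴹ = SetoidReasoning ≈ᴹ-setoid
        s′ = s * μ v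

        νus′≈1 : ν u * s′ ≈ 1#
        νus′≈1 = trans (*-comm _ _) (trans (*-assoc _ _ _) sμvνu≈1)

        into : ∀ {x} → Ker V scalars ν P x → Ker V scalars μ P (x +ᴹ (- μ x) *ₗ u)
        into {x} (px , _) = +ᴹ-closed P-sub px (*ₗ-closed P-sub _ pu) ,
          trans (+*-homo M x _ u) (x+-x*1≈0 μu≈1)

        inj : ∀ {x} → Ker V scalars ν P x → x +ᴹ (- μ x) *ₗ u ≈ᴹ 0ᴹ → x ≈ᴹ 0ᴹ
        inj {x} (_ , νx≈0) ρx≈0 = ᴹ.begin
          x                  ᴹ.≈⟨ +ᴹ-identityʳ x ⟨
          x +ᴹ 0ᴹ            ᴹ.≈⟨ +ᴹ-cong ≈ᴹ-refl (*ₗ-zeroˡ u) ⟨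
          x +ᴹ 0# *ₗ u       ᴹ.≈⟨ +ᴹ-cong ≈ᴹ-refl (*ₗ-cong -μx≈0 ≈ᴹ-refl) ⟨
          x +ᴹ (- μ x) *ₗ u  ᴹ.≈⟨ ρx≈0 ⟩
          0ᴹ                 ᴹ.∎
          where
          -μx≈0 : - μ x ≈ 0#
          -μx≈0 = begin
            - μ x                       ≈⟨ *-identityʳ _ ⟨
            - μ x * 1#                  ≈⟨ *-congˡ νus′≈1 ⟨
            - μ x * (ν u * s′)          ≈⟨ *-assoc _ _ _ ⟨
            - μ x * ν u * s′            ≈⟨ *-congʳ (+-identityˡ _) ⟨
            (0# + - μ x * ν u) * s′     ≈⟨ *-congʳ (+-congʳ νx≈0) ⟨
            (ν x + - μ x * ν u) * s′    ≈⟨ *-congʳ (+*-homo N x _ u) ⟨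
            ν (x +ᴹ (- μ x) *ₗ u) * s′  ≈⟨ *-congʳ (trans (⟦⟧-cong N ρx≈0) (0-homo N)) ⟩
            0# * s′                     ≈⟨ zeroˡ _ ⟩
            0#                          ∎

        surj : ∀ {y} → Ker V scalars μ P y →
               ∃ λ x → Ker V scalars ν P x × x +ᴹ (- μ x) *ₗ u ≈ᴹ y
        surj {y} (py , μy≈0) = x , (+ᴹ-closed P-sub py (*ₗ-closed P-sub _ pu) , νx≈0) , ρx≈y
          where
          -- `s′` inverts `ν u`, so `r` is the multiple of `u` whose removal takes `y` into the
          -- kernel of `ν`. Since `μ y ≈ 0#`, the projection off `u` puts exactly this multiple
          -- back.
          r = ν y * s′
          x = y +ᴹ (- r) *ₗ u
          νx≈0 : ν x ≈ 0#
          νx≈0 = begin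
            ν x                ≈⟨ +*-homo N y _ u ⟩
            ν y + - r * ν u    ≈⟨ +-congˡ (-‿distribˡ-* r (ν u)) ⟨
            ν y + - (r * ν u)  ≈⟨ +-congˡ (-‿cong (trans (*-assoc _ _ _)
                                  (trans (*-congˡ (trans (*-comm _ _) νus′≈1)) (*-identityʳ _)))) ⟩
            ν y - ν y          ≈⟨ -‿inverseʳ _ ⟩
            0#                 ∎
          μx≈-r : μ x ≈ - r
          μx≈-r = begin
            μ x              ≈⟨ +*-homo M y _ u ⟩
            μ y + - r * μ u  ≈⟨ +-cong μy≈0 (*-congˡ μu≈1) ⟩
            0# + - r * 1#    ≈⟨ +-identityˡ _ ⟩
            - r * 1#         ≈⟨ *-identityʳ _ ⟩
            - r              ∎
          ρx≈y : x +ᴹ (- μ x) *ₗ u ≈ᴹ y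
          ρx≈y = ᴹ.begin
            (y +ᴹ (- r) *ₗ u) +ᴹ (- μ x) *ₗ u  ᴹ.≈⟨ +ᴹ-assoc _ _ _ ⟩
            y +ᴹ ((- r) *ₗ u +ᴹ (- μ x) *ₗ u)  ᴹ.≈⟨ +ᴹ-cong ≈ᴹ-refl (*ₗ-distribʳ _ _ _) ⟨
            y +ᴹ (- r + - μ x) *ₗ u            ᴹ.≈⟨ +ᴹ-cong ≈ᴹ-refl (*ₗ-cong
                                                  (trans (+-congˡ (-‿cong μx≈-r)) (-‿inverseʳ _)) ≈ᴹ-refl) ⟩
            y +ᴹ 0# *ₗ u                       ᴹ.≈⟨ +ᴹ-cong ≈ᴹ-refl (*ₗ-zeroˡ u) ⟩
            y +ᴹ 0ᴹ                            ᴹ.≈⟨ +ᴹ-identityʳ y ⟩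
            y                                  ᴹ.∎

  -- Induction on the flag of the image: each of its functionals, pulled back along `φ`, lowers the
  -- dimension of the domain by one, and what remains at the end is the kernel. That the kernel has
  -- a dimension at all is part of the conclusion.
  rank-nullity : ∀ {V W φ P Q n r} → IsLinear V W φ → IsSubspace V P →
    (∀ {x} → P x → Q (φ x)) →
    (∀ {y} → Q y → ∃ λ x → P x × S._≈ᴹ_ W (φ x) y) →
    HasDim V P n → HasDim W Q r →
    ∃ λ k → n ≡ r ℕ.+ k × HasDim V (Ker V W φ P) k
  rank-nullity {n = n} Φ P-sub into surj D (trivial Q≈0) =
    n , ≡.refl , HasDim-resp (λ (px , _) → px) (λ px → px , Q≈0 (into px)) D
  rank-nullity {V} {W} {φ} {P} {Q} Φ P-sub into surj D (hyperplane {μ = μ} M qu μu≈1 E)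
    with surj qu
  ... | u′ , pu′ , φu′≈u
    with Ker-functional-dim P-sub D M∘Φ pu′ (trans (⟦⟧-cong M φu′≈u) μu≈1)
    where M∘Φ = ∘-linear M Φ
  ... | _ , ≡.refl , D′
    with rank-nullity Φ (Ker-isSubspace (∘-linear M Φ) P-sub) (λ (px , z) → into px , z) surj′ D′ E
    where
    surj′ : ∀ {y} → Ker W scalars μ Q y →
            ∃ λ x → Ker V scalars (λ x → μ (φ x)) P x × S._≈ᴹ_ W (φ x) y
    surj′ (qy , μy≈0) with surj qy
    ... | x , px , φx≈y = x , (px , trans (⟦⟧-cong M φx≈y) μy≈0) , φx≈y
  -- The section by `μ` after `φ` does not shrink the kernel of `φ`: there `μ (φ x) ≈ 0#` holds
  -- anyway.
  ... | k , ≡.refl , D″ = k , ≡.refl , HasDim-resp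
    (λ (px , φx≈0) → (px , trans (⟦⟧-cong M φx≈0) (0-homo M)) , φx≈0)
    (λ ((px , _) , φx≈0) → px , φx≈0) D″

-- Graded free modules over the polynomial ring as vector spaces.

module Graded {c ℓ₁ ℓ₂} (𝐤 : HeytingField c ℓ₁ ℓ₂) (m : ℕ) where

  open HeytingField 𝐤 using (heytingCommutativeRing; #-irrefl; #-cotrans; #⇒invertible)

  K : CommutativeRing c ℓ₁
  K = HeytingCommutativeRing.commutativeRing heytingCommutativeRing

  open CommutativeRing K hiding (zero)
  open SetoidReasoning setoid

  1≉0 : Nontrivial K
  1≉0 1≈0 = #-irrefl 1≈0 (1#0 heytingCommutativeRing)

  -- Since 1 is apart from 0, cotransitivity makes `y` apart from 1 or from 0. Elements that are
  -- apart have an invertible difference, here `1# - y ≈ x` or `y - 0# ≈ y`.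
  local : Local K
  local {x} {y} x+y≈1 with #-cotrans (1#0 heytingCommutativeRing) y
  ... | inj₁ 1#y with #⇒invertible 1#y
  ...   | s , s[1-y]≈1 , _ = inj₁ (s , trans (*-congˡ (sym 1-y≈x)) s[1-y]≈1)
    where
    1-y≈x : 1# - y ≈ x
    1-y≈x = trans (+-congʳ (sym x+y≈1))
      (trans (+-assoc x y (- y)) (trans (+-congˡ (-‿inverseʳ y)) (+-identityʳ x)))
  local {x} {y} x+y≈1 | inj₂ y#0 with #⇒invertible y#0
  ...   | s , s[y-0]≈1 , _ = inj₂ (s , trans (*-congˡ (sym (x-0≈x heytingCommutativeRing y))) s[y-0]≈1)

  open LinearAlgebra K 1≉0 local
  open IsLinear
  open StanleyReisner 𝐤 m
  private module 𝐤[v] = CommutativeRing 𝐤[v]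

  coeff-++ : ∀ p q e → coeff (p ++ q) e ≈ coeff p e + coeff q e
  coeff-++ []            q e = sym (+-identityˡ _)
  coeff-++ ((r , a) ∷ p) q e = trans (+-congˡ (coeff-++ p q e)) (sym (+-assoc _ _ _))

  coeff-term-≡ : ∀ r a → coeff ((r , a) ∷ []) a ≈ r
  coeff-term-≡ r a = trans (+-identityʳ _)
    (reflexive (≡.cong (λ z → if z then r else 0#) (dec-true (a ≟ᵈ a) ≡.refl)))

  coeff-term-≢ : ∀ r {a e} → a ≢ e → coeff ((r , a) ∷ []) e ≈ 0#
  coeff-term-≢ r {a} {e} a≢e = trans (+-identityʳ _)
    (reflexive (≡.cong (λ z → if z then r else 0#) (dec-false (a ≟ᵈ e) a≢e)))

  const : Carrier → Poly
  const r = (r , 𝟎) ∷ []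

  coeff-const : ∀ r e → coeff (const r) e ≈ r * kronecker e 𝟎
  coeff-const r e = trans (coeff≈pair (const r) e) (+-identityʳ _)

  coeff-const-* : ∀ r p e → coeff (const r *ᴾ p) e ≈ r * coeff p e
  coeff-const-* r p e = begin
    coeff (const r *ᴾ p) e                               ≈⟨ coeff≈pair (const r *ᴾ p) e ⟩
    pair (const r *ᴾ p) (kronecker e)                    ≈⟨ pair-*ᴾ (const r) p (kronecker e) ⟩
    r * pair p (λ b → kronecker e (𝟎 ⊕ b)) + 0#          ≈⟨ +-identityʳ _ ⟩
    r * pair p (λ b → kronecker e (𝟎 ⊕ b))               ≈⟨ *-congˡ (pair-cong p λ b →
                                                              reflexive (≡.cong (kronecker e) (⊕-identityˡ b))) ⟩
    r * pair p (kronecker e)                             ≈⟨ *-congˡ (coeff≈pair p e) ⟨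
    r * coeff p e                                        ∎

  const-cong : ∀ {r s} → r ≈ s → const r ≈ᴾ const s
  const-cong {r} {s} r≈s = mk≈ᴾ λ e →
    trans (coeff-const r e) (trans (*-congʳ r≈s) (sym (coeff-const s e)))

  const-0 : const 0# ≈ᴾ []
  const-0 = mk≈ᴾ λ e → trans (coeff-const 0# e) (zeroˡ _)

  const-+ : ∀ r s → const (r + s) ≈ᴾ const r ++ const s
  const-+ r s = mk≈ᴾ λ e → begin
    coeff (const (r + s)) e                    ≈⟨ coeff-const (r + s) e ⟩
    (r + s) * kronecker e 𝟎                    ≈⟨ distribʳ _ r s ⟩
    r * kronecker e 𝟎 + s * kronecker e 𝟎      ≈⟨ +-cong (coeff-const r e) (coeff-const s e) ⟨
    coeff (const r) e + coeff (const s) e      ≈⟨ coeff-++ (const r) (const s) e ⟨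
    coeff (const r ++ const s) e               ∎

  const-* : ∀ r s → const (r * s) ≈ᴾ const r *ᴾ const s
  const-* r s = mk≈ᴾ λ e → begin
    coeff (const (r * s)) e            ≈⟨ coeff-const (r * s) e ⟩
    r * s * kronecker e 𝟎              ≈⟨ *-assoc r s _ ⟩
    r * (s * kronecker e 𝟎)            ≈⟨ *-congˡ (coeff-const s e) ⟨
    r * coeff (const s) e              ≈⟨ coeff-const-* r (const s) e ⟨
    coeff (const r *ᴾ const s) e       ∎

  restrictScalars : Module 𝐤[v] c ℓ₁ → Space
  restrictScalars M = record
    { Carrierᴹ = Carrierᴹ ; _≈ᴹ_ = _≈ᴹ_ ; _+ᴹ_ = _+ᴹ_ ; _*ₗ_ = λ r x → const r *ₗ x ; 0ᴹ = 0ᴹ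
    ; isLeftSemimodule = record
      { +ᴹ-isCommutativeMonoid = +ᴹ-isCommutativeMonoid
      ; isPreleftSemimodule = record
        { *ₗ-cong      = λ r≈s → *ₗ-cong (const-cong r≈s)
        ; *ₗ-zeroˡ     = λ x → ≈ᴹ-trans (*ₗ-cong const-0 ≈ᴹ-refl) (*ₗ-zeroˡ x)
        ; *ₗ-distribʳ  = λ x r s → ≈ᴹ-trans (*ₗ-cong (const-+ r s) ≈ᴹ-refl) (*ₗ-distribʳ x _ _)
        ; *ₗ-identityˡ = *ₗ-identityˡ
        ; *ₗ-assoc     = λ r s x → ≈ᴹ-trans (*ₗ-cong (const-* r s) ≈ᴹ-refl) (*ₗ-assoc _ _ x)
        ; *ₗ-zeroʳ     = λ r → *ₗ-zeroʳ (const r)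
        ; *ₗ-distribˡ  = λ r → *ₗ-distribˡ (const r)
        }
      }
    }
    where open Module M

  FreeSpace : GradedFree → Space
  FreeSpace as = restrictScalars (Free as)

  private module FS as = LeftSemimodule (FreeSpace as)

  restrictScalars-linear : ∀ {M N : Module 𝐤[v] c ℓ₁} {φ} →
    IsModuleHomomorphism (Module.rawModule M) (Module.rawModule N) φ →
    IsLinear (restrictScalars M) (restrictScalars N) φ
  restrictScalars-linear Φ = record
    { ⟦⟧-cong = Φ.⟦⟧-cong ; +-homo = Φ.+ᴹ-homo ; *-homo = λ r → Φ.*ₗ-homo (const r) }
    where module Φ = IsModuleHomomorphism Φ

  coeff-linear : ∀ as j e → IsLinear (FreeSpace as) scalars (λ x → coeff (x j) e)
  coeff-linear as j e = record
    { ⟦⟧-cong = λ x≈y → coeff-≈ (x≈y j) e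
    ; +-homo  = λ x y → coeff-++ (x j) (y j) e
    ; *-homo  = λ r x → coeff-const-* r (x j) e
    }

  single : ∀ {n} → Fin n → Poly → Vector Poly n
  single zero    p = p Vector.∷ Vector.replicate _ []
  single (suc j) p = [] Vector.∷ single j p

  single-homogeneous : ∀ as j r a → HomogeneousFree as (a ⊕ List.lookup as j) (single j ((r , a) ∷ []))
  single-homogeneous (_ ∷ _)  zero    r a zero    e e≢ = coeff-term-≢ r λ a≡e → e≢ (≡.cong (_⊕ _) (≡.sym a≡e))
  single-homogeneous (_ ∷ _)  zero    r a (suc i) e e≢ = refl
  single-homogeneous (_ ∷ _)  (suc j) r a zero    e e≢ = refl
  single-homogeneous (_ ∷ as) (suc j) r a (suc i) e e≢ = single-homogeneous as j r a i e e≢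

  -- A `Poly` is a formal sum of terms, so the one-term vectors generate additively, without any
  -- test of coefficients for zero.
  single-induction : ∀ n {p} (P : Vector Poly n → Set p) →
    (∀ {x y} → (∀ j → x j ≈ᴾ y j) → P x → P y) →
    P (Vector.replicate n []) →
    (∀ {x y} → P x → P y → P (λ j → x j ++ y j)) →
    (∀ j r a → P (single j ((r , a) ∷ []))) →
    ∀ x → P x
  single-induction zero    P resp P0 P+ Ps x = resp (λ ()) P0
  single-induction (suc n) P resp P0 P+ Ps x =
    resp (λ { zero → 𝐤[v].+-identityʳ _ ; (suc j) → 𝐤[v].refl })
      (P+ (first (x zero)) (rest (λ j → x (suc j))))
    where
    first : ∀ p → P (single zero p)
    first []            = resp (λ { zero → 𝐤[v].refl ; (suc j) → 𝐤[v].refl }) P0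
    first ((r , a) ∷ p) = resp (λ { zero → 𝐤[v].refl ; (suc j) → 𝐤[v].refl })
      (P+ (Ps zero r a) (first p))
    rest : ∀ y → P ([] Vector.∷ y)
    rest = single-induction n (λ y → P ([] Vector.∷ y))
      (λ y≈z → resp λ { zero → 𝐤[v].refl ; (suc j) → y≈z j })
      (resp (λ { zero → 𝐤[v].refl ; (suc j) → 𝐤[v].refl }) P0)
      (λ py pz → resp (λ { zero → 𝐤[v].refl ; (suc j) → 𝐤[v].refl }) (P+ py pz))
      (λ j → Ps (suc j))

  -- One-term vectors are homogeneous. The lemma carries `d-graded` and `ε-graded`, which speak of
  -- homogeneous elements only, over to arbitrary ones.
  linear-ext : ∀ {as W φ ψ} → IsLinear (FreeSpace as) W φ → IsLinear (FreeSpace as) W ψ →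
    (∀ b x → HomogeneousFree as b x → LeftSemimodule._≈ᴹ_ W (φ x) (ψ x)) →
    ∀ x → LeftSemimodule._≈ᴹ_ W (φ x) (ψ x)
  linear-ext {as} {W} {φ} {ψ} Φ Ψ agree = single-induction (length as) (λ x → φ x ≈ᴹ ψ x)
    (λ x≈y φx≈ψx → ≈ᴹ-trans (≈ᴹ-sym (⟦⟧-cong Φ x≈y)) (≈ᴹ-trans φx≈ψx (⟦⟧-cong Ψ x≈y)))
    (≈ᴹ-trans (0-homo Φ) (≈ᴹ-sym (0-homo Ψ)))
    (λ px py → ≈ᴹ-trans (+-homo Φ _ _) (≈ᴹ-trans (+ᴹ-cong px py) (≈ᴹ-sym (+-homo Ψ _ _))))
    (λ j r a → agree _ _ (single-homogeneous as j r a))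
    where open LeftSemimodule W

  -- A record, since HomogeneousFree lives at a lower level than SubsetOf demands.
  record Piece (as : GradedFree) (e : Degree m) (x : Vector Poly (length as)) : Set (c ⊔ ℓ₁) where
    constructor piece
    field homogeneous : HomogeneousFree as e x

  Piece-isSubspace : ∀ as e → IsSubspace (FreeSpace as) (Piece as e)
  Piece-isSubspace as e = record
    { +ᴹ-closed = λ {x} {y} (piece hx) (piece hy) → piece λ j e′ e′≢ →
        trans (coeff-++ (x j) (y j) e′) (trans (+-cong (hx j e′ e′≢) (hy j e′ e′≢)) (+-identityˡ 0#))
    ; *ₗ-closed = λ r {x} (piece hx) → piece λ j e′ e′≢ →
        trans (coeff-const-* r (x j) e′) (trans (*-congˡ (hx j e′ e′≢)) (zeroʳ r))
    }

  tail-linear : ∀ a as → IsLinear (FreeSpace (a ∷ as)) (FreeSpace as) (λ x j → x (suc j))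
  tail-linear a as = record
    { ⟦⟧-cong = λ x≈y j → x≈y (suc j)
    ; +-homo  = λ _ _ _ → 𝐤[v].refl
    ; *-homo  = λ _ _ _ → 𝐤[v].refl
    }

  -- A generator of degree `a` with `a ⊕ b ≡ e` contributes one coordinate, the coefficient of its
  -- component at `b`. If `a` does not divide `e`, that component vanishes on the whole piece.
  Piece-dim : ∀ as e → HasDim (FreeSpace as) (Piece as e) (rankAt e as)
  Piece-dim []       e = trivial λ _ ()
  Piece-dim (a ∷ as) e with subtract? a e
  ... | yes (b , a⊕b≡e) = hyperplane (coeff-linear (a ∷ as) zero b) u-homogeneous (coeff-term-≡ 1# b)
    (HasDim-pullback {Q = Piece as e} (tail-linear a as)
      (λ (piece hx , _) → piece λ j → hx (suc j)) inj surj (Piece-dim as e))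
    where
    u-homogeneous : Piece (a ∷ as) e (single zero (monomial b))
    u-homogeneous = piece (≡.subst (λ e → HomogeneousFree (a ∷ as) e (single zero (monomial b)))
      (≡.trans (⊕-comm b a) a⊕b≡e) (single-homogeneous (a ∷ as) zero 1# b))
    inj : ∀ {x} → Ker (FreeSpace (a ∷ as)) scalars (λ x → coeff (x zero) b) (Piece (a ∷ as) e) x →
          (∀ j → x (suc j) ≈ᴾ []) → ∀ j → x j ≈ᴾ []
    inj {x} (piece hx , x₀≈0) x₊≈0 (suc j) = x₊≈0 j
    inj {x} (piece hx , x₀≈0) x₊≈0 zero    = mk≈ᴾ at
      where
      at : ∀ e′ → coeff (x zero) e′ ≈ 0#
      at e′ with b ≟ᵈ e′
      ... | yes ≡.refl = x₀≈0
      ... | no  b≢e′   = hx zero e′ λ e′⊕a≡e → b≢e′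
        (⊕-cancelˡ a (≡.trans a⊕b≡e (≡.trans (≡.sym e′⊕a≡e) (⊕-comm e′ a))))
    surj : ∀ {y} → Piece as e y → ∃ λ x →
           Ker (FreeSpace (a ∷ as)) scalars (λ x → coeff (x zero) b) (Piece (a ∷ as) e) x ×
           (∀ j → x (suc j) ≈ᴾ y j)
    surj {y} (piece hy) = [] Vector.∷ y ,
      (piece (λ { zero _ _ → refl ; (suc j) → hy j }) , refl) , λ _ → 𝐤[v].refl
  ... | no ¬a≤e = HasDim-pullback {Q = Piece as e} (tail-linear a as)
      (λ (piece hx) → piece λ j → hx (suc j)) inj surj (Piece-dim as e)
    where
    inj : ∀ {x} → Piece (a ∷ as) e x → (∀ j → x (suc j) ≈ᴾ []) → ∀ j → x j ≈ᴾ []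
    inj (piece hx) x₊≈0 (suc j) = x₊≈0 j
    inj (piece hx) x₊≈0 zero    = mk≈ᴾ λ e′ → hx zero e′ λ e′⊕a≡e →
      ¬a≤e (e′ , ≡.trans (⊕-comm a e′) e′⊕a≡e)
    surj : ∀ {y} → Piece as e y → ∃ λ x → Piece (a ∷ as) e x × (∀ j → x (suc j) ≈ᴾ y j)
    surj {y} (piece hy) = [] Vector.∷ y ,
      piece (λ { zero _ _ → refl ; (suc j) → hy j }) , λ _ → 𝐤[v].refl

  -- The degree-e part of p as an element of the summand 𝐤[v](-a).
  component : Degree m → Degree m → Poly → Poly
  component a e p with subtract? a e
  ... | yes (b , _) = (coeff p b , b) ∷ []
  ... | no  _       = []

  component-on : ∀ {a e e′} p → e′ ⊕ a ≡ e → coeff (component a e p) e′ ≈ coeff p e′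
  component-on {a} {e} {e′} p e′⊕a≡e with subtract? a e
  ... | no ¬a≤e = contradiction (e′ , ≡.trans (⊕-comm a e′) e′⊕a≡e) ¬a≤e
  ... | yes (b , a⊕b≡e) with ⊕-cancelˡ a (≡.trans a⊕b≡e (≡.trans (≡.sym e′⊕a≡e) (⊕-comm e′ a)))
  ...   | ≡.refl = coeff-term-≡ (coeff p b) b

  component-off : ∀ {a e e′} p → e′ ⊕ a ≢ e → coeff (component a e p) e′ ≈ 0#
  component-off {a} {e} {e′} p e′⊕a≢e with subtract? a e
  ... | no  _           = refl
  ... | yes (b , a⊕b≡e) = coeff-term-≢ (coeff p b) λ b≡e′ →
    e′⊕a≢e (≡.trans (⊕-comm e′ a) (≡.trans (≡.cong (a ⊕_) (≡.sym b≡e′)) a⊕b≡e))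

  component-unique : ∀ {a e} p {q} →
    (∀ {e′} → e′ ⊕ a ≡ e → coeff p e′ ≈ coeff q e′) →
    (∀ {e′} → e′ ⊕ a ≢ e → coeff q e′ ≈ 0#) →
    component a e p ≈ᴾ q
  component-unique {a} {e} p {q} on off = mk≈ᴾ at
    where
    at : ∀ e′ → coeff (component a e p) e′ ≈ coeff q e′
    at e′ with (e′ ⊕ a) ≟ᵈ e
    ... | yes eq = trans (component-on p eq) (on eq)
    ... | no neq = trans (component-off p neq) (sym (off neq))

  π : ∀ as → Degree m → Vector Poly (length as) → Vector Poly (length as)
  π as e x j = component (List.lookup as j) e (x j)

  π-Piece : ∀ as e x → Piece as e (π as e x)
  π-Piece as e x = piece λ j e′ → component-off (x j)

  π-linear : ∀ as e → IsLinear (FreeSpace as) (FreeSpace as) (π as e)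
  π-linear as e = record
    { ⟦⟧-cong = λ {x} {y} x≈y j → component-unique (x j)
        (λ {e′} on → trans (coeff-≈ (x≈y j) e′) (sym (component-on (y j) on)))
        (component-off (y j))
    ; +-homo = λ x y j → let πx = π as e x j ; πy = π as e y j in component-unique (x j ++ y j)
        (λ {e′} on → trans (coeff-++ (x j) (y j) e′)
          (sym (trans (coeff-++ πx πy e′) (+-cong (component-on (x j) on) (component-on (y j) on)))))
        (λ {e′} off → trans (coeff-++ πx πy e′)
          (trans (+-cong (component-off (x j) off) (component-off (y j) off)) (+-identityˡ 0#)))
    ; *-homo = λ r x j → let πx = π as e x j in component-unique (const r *ᴾ x j)
        (λ {e′} on → trans (coeff-const-* r (x j) e′)
          (sym (trans (coeff-const-* r πx e′) (*-congˡ (component-on (x j) on)))))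
        (λ {e′} off → trans (coeff-const-* r πx e′)
          (trans (*-congˡ (component-off (x j) off)) (zeroʳ r)))
    }

  π-same : ∀ as {e x} → HomogeneousFree as e x → FS._≈ᴹ_ as (π as e x) x
  π-same as {x = x} hx j = component-unique (x j) (λ _ → refl) (λ {e′} → hx j e′)

  π-other : ∀ as {b e x} → b ≢ e → HomogeneousFree as b x → FS._≈ᴹ_ as (π as e x) (FS.0ᴹ as)
  π-other as {x = x} b≢e hx j = component-unique (x j)
    (λ {e′} e′⊕a≡e → hx j e′ λ e′⊕a≡b → b≢e (≡.trans (≡.sym e′⊕a≡b) e′⊕a≡e)) (λ _ → refl)

  -- On homogeneous elements `π` is the identity or zero according to whether the degree is `e`, and
  -- a graded map preserves that distinction.
  π-natural : ∀ {as bs φ} e → IsLinear (FreeSpace as) (FreeSpace bs) φ →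
    (∀ b x → HomogeneousFree as b x → HomogeneousFree bs b (φ x)) →
    ∀ x → FS._≈ᴹ_ bs (φ (π as e x)) (π bs e (φ x))
  π-natural {as} {bs} {φ} e Φ graded =
    linear-ext {as} {FreeSpace bs} (∘-linear {V = FreeSpace as} Φ (π-linear as e))
                                   (∘-linear {V = FreeSpace bs} (π-linear bs e) Φ) agree
    where
    agree : ∀ b x → HomogeneousFree as b x → FS._≈ᴹ_ bs (φ (π as e x)) (π bs e (φ x))
    agree b x hx with b ≟ᵈ e
    ... | yes ≡.refl = FS.≈ᴹ-trans bs (⟦⟧-cong Φ (π-same as hx))
      (FS.≈ᴹ-sym bs (π-same bs (graded b x hx)))
    ... | no  b≢e    = FS.≈ᴹ-trans bs (⟦⟧-cong Φ (π-other as b≢e hx))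
      (FS.≈ᴹ-trans bs (0-homo Φ) (FS.≈ᴹ-sym bs (π-other bs b≢e (graded b x hx))))

  -- The face ring in a squarefree degree: one-dimensional at a face, zero elsewhere.

  indicator-∣⇒⊆ : ∀ {n} (τ b : Subset n) d → indicator τ ⊕ d ≡ indicator b → τ ⊆ b
  indicator-∣⇒⊆ []              []              _            _  = λ ()
  indicator-∣⇒⊆ (outside ∷ τ)   (_ ∷ b)         (_ ∷ d)  eq = out⊆ (indicator-∣⇒⊆ τ b d (Vec.∷-injectiveʳ eq))
  indicator-∣⇒⊆ (inside ∷ τ)    (inside ∷ b)    (_ ∷ d)  eq = s⊆s (indicator-∣⇒⊆ τ b d (Vec.∷-injectiveʳ eq))
  indicator-∣⇒⊆ (inside ∷ τ)    (outside ∷ b)   (_ ∷ d)  ()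

  module _ (Δ : Pred (Subset m) 0ℓ) where

    -- In other words, the support of e is a face.
    Supported : Pred (Degree m) 0ℓ
    Supported e = ∀ τ d → indicator τ ⊕ d ≡ e → Δ τ

    face-supported : IsSimplicialComplex Δ → ∀ {b} → Δ b → Supported (indicator b)
    face-supported Δ-complex Δb τ d eq =
      IsSimplicialComplex.down-closed Δ-complex (indicator-∣⇒⊆ τ _ d eq) Δb

    Supported-factor : ∀ {a d} → Supported (a ⊕ d) → Supported d
    Supported-factor {a} {d} e∈Δ τ b τ⊕b≡d = e∈Δ τ (b ⊕ a)
      (≡.trans (≡.sym (⊕-assoc (indicator τ) b a)) (≡.trans (≡.cong (_⊕ a) τ⊕b≡d) (⊕-comm d a)))

    -- A monomial divisible by a nonface is not supported. For a product `r *ᴾ x` the coefficient at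
    -- `e` involves those of `x` at divisors of `e`, so the induction runs over all supported
    -- degrees at once.
    ideal-coeff≈0 : ∀ {p} → ⟨ 𝐤[v] ⟩ (Nonfaces Δ) p → ∀ {e} → Supported e → coeff p e ≈ 0#
    ideal-coeff≈0 (generator (τ , ¬Δτ , ≡.refl)) {e} e∈Δ = coeff-term-≢ 1# λ τ≡e →
      ¬Δτ (e∈Δ τ 𝟎 (≡.trans (⊕-comm (indicator τ) 𝟎) (≡.trans (⊕-identityˡ (indicator τ)) τ≡e)))
    ideal-coeff≈0 0∈                     e∈Δ = refl
    ideal-coeff≈0 (+-closed {x} {y} p q) {e} e∈Δ = trans (coeff-++ x y e)
      (trans (+-cong (ideal-coeff≈0 p e∈Δ) (ideal-coeff≈0 q e∈Δ)) (+-identityˡ 0#))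
    ideal-coeff≈0 (resp-≈ x≈y p) {e} e∈Δ = trans (sym (coeff-≈ x≈y e)) (ideal-coeff≈0 p e∈Δ)
    ideal-coeff≈0 (*-closed r {x} p) {e} e∈Δ = begin
      coeff (r *ᴾ x) e                                     ≈⟨ coeff≈pair (r *ᴾ x) e ⟩
      pair (r *ᴾ x) (kronecker e)                          ≈⟨ pair-*ᴾ r x (kronecker e) ⟩
      pair r (λ a → pair x (λ b → kronecker e (a ⊕ b)))    ≈⟨ pair-cong r shifted≈0 ⟩
      pair r (λ _ → 0#)                                    ≈⟨ pair-zero r ⟩
      0#                                                   ∎
      where
      shifted≈0 : ∀ a → pair x (λ b → kronecker e (a ⊕ b)) ≈ 0#
      shifted≈0 a with subtract? a e
      ... | yes (d , ≡.refl) = begin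
        pair x (λ b → kronecker (a ⊕ d) (a ⊕ b))   ≈⟨ pair-cong x (λ b → reflexive (≡.cong (λ z → if z then 1# else 0#)
                                                        (does-⇔ (mk⇔ (⊕-cancelˡ a) (≡.cong (a ⊕_))) ((a ⊕ b) ≟ᵈ (a ⊕ d)) (b ≟ᵈ d)))) ⟩
        pair x (kronecker d)                       ≈⟨ coeff≈pair x d ⟨
        coeff x d                                  ≈⟨ ideal-coeff≈0 p (Supported-factor e∈Δ) ⟩
        0#                                         ∎
      ... | no ¬a≤e = trans
        (pair-cong x λ b → reflexive (≡.cong (λ z → if z then 1# else 0#)
          (dec-false ((a ⊕ b) ≟ᵈ e) λ eq → ¬a≤e (b , eq))))
        (pair-zero x)

    private module M = Module (FaceModule Δ)

    -- This makes the coefficient at a supported degree a well-defined functional on the face ring.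
    coeff-mod : ∀ {p q e} → Supported e → p M.≈ᴹ q → coeff p e ≈ coeff q e
    coeff-mod {p} {q} {e} e∈Δ (mk≈ p-q∈I) = GroupProperties.x∙y⁻¹≈ε⇒x≈y +-group _ _ (begin
      coeff p e - coeff q e        ≈⟨ +-congˡ coeff-neg ⟨
      coeff p e + coeff (-ᴾ q) e   ≈⟨ coeff-++ p (-ᴾ q) e ⟨
      coeff (p ++ -ᴾ q) e          ≈⟨ ideal-coeff≈0 p-q∈I e∈Δ ⟩
      0#                           ∎)
      where
      coeff-neg : coeff (-ᴾ q) e ≈ - coeff q e
      coeff-neg = trans (coeff≈pair (-ᴾ q) e)
        (trans (pair-neg q (kronecker e)) (-‿cong (sym (coeff≈pair q e))))

    homogeneous≈0 : ∀ {e q} → HomogeneousPoly e q → coeff q e ≈ 0# → q M.≈ᴹ M.0ᴹ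
    homogeneous≈0 {e} {q} hq q≈0 = ≈⇒≈mod 𝐤[v] (Nonfaces Δ) (mk≈ᴾ at)
      where
      at : ∀ e′ → coeff q e′ ≈ 0#
      at e′ with e′ ≟ᵈ e
      ... | yes ≡.refl = q≈0
      ... | no  e′≢e   = hq e′ e′≢e

    nonface-homogeneous≈0 : ∀ {b q} → ¬ Δ b → HomogeneousPoly (indicator b) q → q M.≈ᴹ M.0ᴹ
    nonface-homogeneous≈0 {b} {q} ¬Δb hq =
      mk≈ (resp-≈ eq (*-closed (const r) (generator (b , ¬Δb , ≡.refl))))
      where
      r = coeff q (indicator b)
      eq : const r *ᴾ (v^ b) ≈ᴾ q ++ []
      eq = 𝐤[v].trans (mk≈ᴾ at) (𝐤[v].sym (𝐤[v].+-identityʳ q))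
        where
        at : ∀ e → coeff (const r *ᴾ (v^ b)) e ≈ coeff q e
        at e with indicator b ≟ᵈ e
        ... | yes ≡.refl = trans (coeff-const-* r (v^ b) e)
          (trans (*-congˡ (coeff-term-≡ 1# e)) (*-identityʳ r))
        ... | no b≢e = trans (coeff-const-* r (v^ b) e)
          (trans (*-congˡ (coeff-term-≢ 1# b≢e)) (trans (zeroʳ r) (sym (hq e λ e≡b → b≢e (≡.sym e≡b)))))

    -- The strand of the resolution in degree `b`.

    module Resolution (res : MinimalFreeResolution Δ) (Δ-complex : IsSimplicialComplex Δ) (b : Subset m) where
      open MinimalFreeResolution res
      private module ε = IsModuleHomomorphism ε-linear

      e : Degree m
      e = indicator b

      -- At index 0 the kernel of `ε` is written out by hand, because the equality of `FaceModule Δ`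
      -- lives at a higher level than that of a `Space`.
      Cycles : ∀ i → SubsetOf (FreeSpace (F i))
      Cycles zero    x = Piece (F 0) e x × ε x M.≈ᴹ M.0ᴹ
      Cycles (suc i)   = Ker (FreeSpace (F (suc i))) (FreeSpace (F i)) (d i) (Piece (F (suc i)) e)

      dᴸ : ∀ i → IsLinear (FreeSpace (F (suc i))) (FreeSpace (F i)) (d i)
      dᴸ i = restrictScalars-linear {Free (F (suc i))} {Free (F i)} (d-linear i)

      boundary-cycle : ∀ i {x} → Piece (F (suc i)) e x → Cycles i (d i x)
      boundary-cycle zero    {x} (piece hx) = piece (d-graded 0 e x hx) , ε∘d≈0 x
      boundary-cycle (suc i) {x} (piece hx) = piece (d-graded (suc i) e x hx) , d∘d≈0 i x

      cycle-piece : ∀ i {x} → Cycles i x → Piece (F i) e x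
      cycle-piece zero    = proj₁
      cycle-piece (suc i) = proj₁

      cycle-boundary : ∀ i {x} → Cycles i x → ∃ λ y → FS._≈ᴹ_ (F i) (d i y) x
      cycle-boundary zero    {x} (_ , εx≈0) = exact-0 x εx≈0
      cycle-boundary (suc i) {x} (_ , dx≈0) = exact i x dx≈0

      -- The degree-`e` part of any preimage is again a preimage: `d i` commutes with `π`, and `π`
      -- fixes the homogeneous `x`.
      cycle-boundary-homogeneous : ∀ i {x} → Cycles i x →
        ∃ λ y → Piece (F (suc i)) e y × FS._≈ᴹ_ (F i) (d i y) x
      cycle-boundary-homogeneous i {x} zx with cycle-boundary i zx
      ... | y , dy≈x = π (F (suc i)) e y , π-Piece (F (suc i)) e y ,
        FS.≈ᴹ-trans (F i) (π-natural {F (suc i)} {F i} e (dᴸ i) (d-graded i) y)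
          (FS.≈ᴹ-trans (F i) (⟦⟧-cong (π-linear (F i) e) dy≈x)
            (π-same (F i) (Piece.homogeneous (cycle-piece i zx))))

      next-cycles : ∀ i {r} → HasDim (FreeSpace (F i)) (Cycles i) r →
        ∃ λ k → rankAt e (F (suc i)) ≡ r ℕ.+ k × HasDim (FreeSpace (F (suc i))) (Cycles (suc i)) k
      next-cycles i = rank-nullity (dᴸ i) (Piece-isSubspace (F (suc i)) e)
        (boundary-cycle i) (cycle-boundary-homogeneous i) (Piece-dim (F (suc i)) e)

      nonface-cycles : ¬ Δ b → HasDim (FreeSpace (F 0)) (Cycles 0) (rankAt e (F 0))
      nonface-cycles ¬Δb = HasDim-resp {P = Cycles 0} proj₁ all (Piece-dim (F 0) e)
        where
        all : ∀ {x} → Piece (F 0) e x → Cycles 0 x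
        all {x} px@(piece hx) with ε-graded e x hx
        ... | q , hq , εx≈q = px , M.≈ᴹ-trans εx≈q (nonface-homogeneous≈0 ¬Δb hq)

      -- On the degree-`e` piece, `ε` is determined by the coefficient of `v^ b` in its value, so
      -- the cycles are the kernel of one functional. It takes the value 1 at the degree-`e` part of
      -- a preimage of `v^ b`.
      face-cycles : Δ b → ∃ λ n → rankAt e (F 0) ≡ suc n × HasDim (FreeSpace (F 0)) (Cycles 0) n
      face-cycles Δb with ε-surjective (v^ b)
      ... | x , εx≈v^b
        with Ker-functional-dim (Piece-isSubspace (F 0) e) (Piece-dim (F 0) e) Λ (π-Piece (F 0) e x) λπx≈1
        where
        e∈Δ : Supported e
        e∈Δ = face-supported Δ-complex Δb

        Λ : IsLinear (FreeSpace (F 0)) scalars (λ x → coeff (ε x) e)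
        Λ = record
          { ⟦⟧-cong = λ x≈y → coeff-mod e∈Δ (ε.⟦⟧-cong x≈y)
          ; +-homo  = λ x y → trans (coeff-mod e∈Δ (ε.+ᴹ-homo x y)) (coeff-++ (ε x) (ε y) e)
          ; *-homo  = λ r x → trans (coeff-mod e∈Δ (ε.*ₗ-homo (const r) x)) (coeff-const-* r (ε x) e)
          }

        agree : ∀ g x → HomogeneousFree (F 0) g x → coeff (ε (π (F 0) e x)) e ≈ coeff (ε x) e
        agree g x hx with g ≟ᵈ e
        ... | yes ≡.refl = ⟦⟧-cong Λ (π-same (F 0) hx)
        ... | no g≢e with ε-graded g x hx
        ...   | q , hq , εx≈q = trans (⟦⟧-cong Λ (π-other (F 0) g≢e hx)) (trans (0-homo Λ)
          (sym (trans (coeff-mod e∈Δ εx≈q) (hq e λ e≡g → g≢e (≡.sym e≡g)))))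

        λπx≈1 : coeff (ε (π (F 0) e x)) e ≈ 1#
        λπx≈1 = begin
          coeff (ε (π (F 0) e x)) e    ≈⟨ linear-ext {F 0} {scalars}
                                            (∘-linear {V = FreeSpace (F 0)} Λ (π-linear (F 0) e)) Λ agree x ⟩
          coeff (ε x) e                ≈⟨ coeff-mod e∈Δ εx≈v^b ⟩
          coeff (v^ b) e               ≈⟨ coeff-term-≡ 1# e ⟩
          1#                           ∎
      ... | n , rank≡ , D = n , rank≡ , HasDim-resp {P = Cycles 0}
        (λ (px , εx≈0) → px , coeff-mod (face-supported Δ-complex Δb) εx≈0) only D
        where
        only : ∀ {x} → Ker (FreeSpace (F 0)) scalars (λ x → coeff (ε x) e) (Piece (F 0) e) x → Cycles 0 x
        only {x} (px@(piece hx) , λx≈0) with ε-graded e x hx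
        ... | q , hq , εx≈q = px , M.≈ᴹ-trans εx≈q
          (homogeneous≈0 hq (trans (sym (coeff-mod (face-supported Δ-complex Δb) εx≈q)) λx≈0))

-- The Euler characteristic of the strand modulo 2.

module RankParity {c ℓ₁ ℓ₂} (𝐤 : HeytingField c ℓ₁ ℓ₂) (m : ℕ)
  (f : 2^[_]*.Carrier m) (f-nice : Nice f)
  (res : StanleyReisner.MinimalFreeResolution 𝐤 m (supp f)) (b : Subset m) where

  open StanleyReisner.MinimalFreeResolution res
  open Graded 𝐤 m
  open LinearAlgebra K 1≉0 local using (HasDim)
  open Resolution (supp f) res f-nice b
  open ≡.≡-Reasoning

  ranks : ℕ → Parity
  ranks i = parity (rankAt e (F i))

  -- `n` is the dimension of the cycles at `i`. The next rank is `n ℕ.+ k`, so its `n` cancels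
  -- modulo 2 and `k` takes its place. The term `f b` enters at index 0, where the rank exceeds the
  -- cycle dimension by 1 at a face and by 0 otherwise.
  euler : ∀ i → ∃ λ n → HasDim (FreeSpace (F i)) (Cycles i) n ×
          ∑ℙ (map ranks (upTo (suc i))) ≡ f b ℙ.+ parity n
  euler zero with f b in fb
  ... | 0ℙ = _ , nonface-cycles (λ fb≡1 → contradiction (≡.trans (≡.sym fb) fb≡1) λ ()) ,
    ℙ.+-identityʳ _
  ... | 1ℙ with face-cycles fb
  ...   | n , rank≡ , D = n , D ,
    ≡.trans (ℙ.+-identityʳ _) (≡.trans (≡.cong parity rank≡) (ℙ.+-homo-+ 1 n))
  euler (suc i) with euler i
  ... | n , D , sum≡ with next-cycles i D
  ...   | k , rank≡ , D′ = k , D′ , (begin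
    ∑ℙ (map ranks (upTo (suc (suc i))))              ≡⟨ ∑ℙ-upTo-suc ranks (suc i) ⟩
    ∑ℙ (map ranks (upTo (suc i))) ℙ.+ ranks (suc i)  ≡⟨ ≡.cong₂ ℙ._+_ sum≡
                                                          (≡.trans (≡.cong parity rank≡) (ℙ.+-homo-+ n k)) ⟩
    f b ℙ.+ parity n ℙ.+ (parity n ℙ.+ parity k)     ≡⟨ ℙ.+-assoc (f b) _ _ ⟩
    f b ℙ.+ (parity n ℙ.+ (parity n ℙ.+ parity k))   ≡⟨ ≡.cong (f b ℙ.+_) (ℙ.+-assoc (parity n) _ _) ⟨
    f b ℙ.+ (parity n ℙ.+ parity n ℙ.+ parity k)     ≡⟨ ≡.cong (λ p → f b ℙ.+ (p ℙ.+ parity k)) (ℙ.p+p≡0ℙ (parity n)) ⟩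
    f b ℙ.+ parity k                                 ∎)

  ∑-ranks : f b ≡ ∑ℙ (map ranks (upTo (suc h)))
  ∑-ranks with euler h
  ... | n , D , sum≡ with next-cycles h D
  ...   | k , rank≡ , _ = ≡.sym (begin
    ∑ℙ (map ranks (upTo (suc h)))  ≡⟨ sum≡ ⟩
    f b ℙ.+ parity n               ≡⟨ ≡.cong (λ n → f b ℙ.+ parity n) n≡0 ⟩
    f b ℙ.+ 0ℙ                     ≡⟨ ℙ.+-identityʳ (f b) ⟩
    f b                            ∎)
    where
    n≡0 : n ≡ 0
    -- One index beyond `h` the rank is 0, and it is the sum of `n` and `k`; no cycles are left at
    -- `h`.
    n≡0 = ℕ.m+n≡0⇒m≡0 n (≡.trans (≡.sym rank≡)
      (≡.cong (rankAt e) (F-zero (suc h) (ℕ.n<1+n h))))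

theorem1p1 : ∀ {c ℓ₁ ℓ₂} (𝐤 : HeytingField c ℓ₁ ℓ₂) (m : ℕ) .{{_ : NonZero m}}
    (f : 2^[_]*.Carrier m) → Nice f → OnVertexSet[m] (supp f) →
    (res : StanleyReisner.MinimalFreeResolution 𝐤 m (supp f)) →
    let open StanleyReisner.MinimalFreeResolution res in
    2^[_]*._≈_ m (ℳ f) (∑ (map (λ i → ∑ (map (λ a → parity (β i a) · δ a) (subsets m))) (upTo (suc h))))
theorem1p1 𝐤 m f f-nice _ res a = begin
  ℳ f a
    ≡⟨ ℳ-cong a (RankParity.∑-ranks 𝐤 m f f-nice res) ⟩
  ℳ (λ b → ∑ℙ (map (λ i → parity (rankAt (indicator b) (F i))) (upTo (suc h)))) a
    ≡⟨ ℳ-∑ℙ (λ i b → parity (rankAt (indicator b) (F i))) (upTo (suc h)) a ⟩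
  ∑ℙ (map (λ i → ℳ (λ b → parity (rankAt (indicator b) (F i))) a) (upTo (suc h)))
    ≡⟨ ≡.cong ∑ℙ (map-cong (λ i → ℳ-rankAt (F i) a) (upTo (suc h))) ⟩
  ∑ℙ (map (λ i → parity (β i a)) (upTo (suc h)))
    ≡⟨ ≡.cong ∑ℙ (map-cong (λ i → ∑-·δ (λ a → parity (β i a)) a) (upTo (suc h))) ⟨
  ∑ℙ (map (λ i → ∑ (map (λ a → parity (β i a) · δ a) (subsets m)) a) (upTo (suc h)))
    ≡⟨ ∑-pointwise (λ i → ∑ (map (λ a → parity (β i a) · δ a) (subsets m))) (upTo (suc h)) a ⟨
  ∑ (map (λ i → ∑ (map (λ a → parity (β i a) · δ a) (subsets m))) (upTo (suc h))) a
    ∎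
  where
  open ≡.≡-Reasoning
  open StanleyReisner.MinimalFreeResolution res
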